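{- Let $T$ be a triangulation of the convex $(n+2)$-gon and let $M_T$ be the corresponding plane perfect matching on $v_1,\dots,v_{2n}$. Every diagonal-flip of $T$ corresponds to either a merge or a split of one of the arcs of $M_T$ whose starting vertex has index greater than one: if $T'$ is obtained from $T$ by flipping one diagonal, then $M_{T'}$ is obtained from $M_T$ by a merge for $\alpha$ or a split of $\alpha$, for some arc $\alpha$ of $M_T$ whose starting vertex $v_p$ satisfies $p>1$. The reverse also holds: if a matching $M'$ is obtained from a plane perfect matching $M$ on $v_1,\dots,v_{2n}$ by a merge for, or a split of, an arc whose starting vertex has index greater than one, then the triangulation $T_{M'}$ is obtained from $T_M$ by a diagonal-flip.
   Context: Let $n\ge 1$. Matchings: plane (non-crossing) perfect matchings on vertices $v_1,\dots,v_{2n}$ in convex position, labeled in clockwise order. Each edge $v_iv_j$ with $i<j$ is directed from $v_i$ to $v_j$ (so $v_i$ is its starting vertex and $v_j$ its ending vertex). The outdegree sequence of a matching $M$ is $B(M)=(b_1,\dots,b_{2n})\in\{0,1\}^{2n}$, where $b_i$ is the outdegree of $v_i$; it determines $M$. Triangulations: triangulations of a convex $(n+2)$-gon with points $p_1,\dots,p_{n+2}$ labeled in clockwise order. Edges $p_ip_j$ with $i<j$ are directed from $p_i$ to $p_j$. The outdegree sequence of $T$ is $D(T)=(d_1,\dots,d_n)$, where $d_i$ is the outdegree of $p_i$, counting all diagonals of $T$ and the boundary edge $p_1p_{n+2}$, but no other boundary edge; it determines $T$. Bijection: $M$ and $T$ correspond to each other (written $T=T_M$, $M=M_T$) if $d_1$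 is the number of 1s before the first 0 in $B(M)$ and, for $2\le i\le n$, $d_i$ is the number of 1s between the $(i-1)$-st 0 and the $i$-th 0 in $B(M)$. This is a bijection between the plane perfect matchings and the triangulations. Diagonal-flip: if $T$ contains the quadrilateral $p_ip_jp_kp_l$ ($i<j<k<l$) as a subgraph, a diagonal-flip exchanges the diagonal of $T$ inside this quadrilateral with the other diagonal of the quadrilateral. Single row presentation: draw $v_1,\dots,v_{2n}$ in one row from left to right, with the matching edges drawn without crossings below as arcs. The section of an arc $v_pv_q$ ($p<q$) is the block of positions $p,p+1,\dots,q$ together with all arcs on these vertices (equivalently, the part of $B(M)$ that starts with the 1 at position $p$ and ends when the numbers of 1s and 0s coincide for the first time). Merge: let $\alpha=v_pv_q$ ($p<q$, $p>2$) be an arc such that $v_{p-1}$ is the ending vertex of an arc $\beta=v_iv_{p-1}$, and let $\mathcal A$ be the section of $\beta$. The merge for $\alpha$ moves the whole section $\mathcal A$ one position to the right, so that it occupies positions $i+1,\dots,p$, and replaces $\alpha$ by $v_iv_q$; all other arcs are unchanged. Split: let $\alpha=v_pv_q$ ($p<q$, $p>1$) be an arc such that $v_{p-1}$ is the starting vertex of an arc $\beta=v_{p-1}v_r$ (then $r>q$). The split of $\alpha$ (from the section of $\beta$) moves the whole section of $\alpha$ one position to the left, so that it occupies positions $p-1,\dots,q-1$, and replaces $\beta$ by $v_qv_r$; all other arcs are unchanged. Split and merge are inverse operations. -}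

module Defs where

open import Data.Fin.Base using (Fin; toℕ; inject₁; _<_; _≤_) renaming (suc to fsuc)
open import Data.Fin.Subset using (Subset; _∈_; _-_; ∣_∣)
open import Data.Nat.Base as ℕ using (ℕ; zero; suc; _+_; _*_)
open import Data.Product using (_×_; ∃₂; ∃!)
open import Data.Sum.Base using (_⊎_)
open import Data.Vec.Base using (Vec; []; _∷_; tabulate)
open import Function.Bundles using (_⇔_)
open import Relation.Binary.PropositionalEquality using (_≡_)
open import Relation.Nullary using (¬_)

-- Points in convex position are numbered clockwise from 1, so that the element
-- i of Fin N stands for the point with label 1 + toℕ i.
label : ∀ {N} → Fin N → ℕ
label i = suc (toℕ i)

-- Directed graphs, given by the set of heads of the edges leaving each vertex.
Graph : ℕ → Set
Graph N = Fin N → Subset N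

Edge : ∀ {N} → Graph N → Fin N → Fin N → Set
Edge G i j = j ∈ G i

Ascending : ∀ {N} → Graph N → Set
Ascending G = ∀ {i j} → Edge G i j → i < j

-- For i < j and k < l, the segments ij and kl between points in convex position
-- have a common interior point iff their endpoints alternate along the polygon.
Crossing : ∀ {N} → Fin N → Fin N → Fin N → Fin N → Set
Crossing i j k l = (i < k × k < j × j < l) ⊎ (k < i × i < l × l < j)

NonCrossing : ∀ {N} → Graph N → Set
NonCrossing G = ∀ {i j k l} → Edge G i j → Edge G k l → ¬ Crossing i j k l

record Matching (n : ℕ) : Set where
  field
    graph       : Graph (2 * n)
    ascending   : Ascending graph
    nonCrossing : NonCrossing graph
    perfect     : ∀ v → ∃! _≡_ λ w → Edge graph v w ⊎ Edge graph w v

-- A triangulation of a convex polygon is a maximal non-crossing set of segments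
-- between its vertices; by maximality it contains all boundary edges.
record Triangulation (n : ℕ) : Set where
  field
    graph       : Graph (2 + n)
    ascending   : Ascending graph
    nonCrossing : NonCrossing graph
    maximal     : ∀ {i j} → i < j →
                  (∀ {k l} → Edge graph k l → ¬ Crossing i j k l) →
                  Edge graph i j

Arc : ∀ {n} → Matching n → Fin (2 * n) → Fin (2 * n) → Set
Arc M = Edge (Matching.graph M)

TEdge : ∀ {n} → Triangulation n → Fin (2 + n) → Fin (2 + n) → Set
TEdge T = Edge (Triangulation.graph T)

B : ∀ {n} → Matching n → Vec ℕ (2 * n)
B M = tabulate λ v → ∣ Matching.graph M v ∣

-- Among the edges leaving pᵢ, where 1 ≤ i ≤ n, the only one that is not counted
-- is the boundary edge pᵢpᵢ₊₁.
D : ∀ {n} → Triangulation n → Fin n → ℕ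
D T i = ∣ Triangulation.graph T (inject₁ (inject₁ i)) - fsuc (inject₁ i) ∣

-- For a 0-1 sequence: the number of 1s before the first 0 if k = 0, and between
-- the k-th and the (k + 1)-st 0 if k > 0.
onesAfterZeros : ∀ {m} → ℕ → Vec ℕ m → ℕ
onesAfterZeros k       []           = 0
onesAfterZeros zero    (zero  ∷ bs) = 0
onesAfterZeros (suc k) (zero  ∷ bs) = onesAfterZeros k bs
onesAfterZeros zero    (suc _ ∷ bs) = suc (onesAfterZeros zero bs)
onesAfterZeros (suc k) (suc _ ∷ bs) = onesAfterZeros (suc k) bs

Corresponds : ∀ {n} → Matching n → Triangulation n → Set
Corresponds {n} M T = (i : Fin n) → D T i ≡ onesAfterZeros (toℕ i) (B M)

-- T' arises from T by exchanging the edge ij for the edge kl.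
Exchange : ∀ {n} → Triangulation n → (i j k l : Fin (2 + n)) → Triangulation n → Set
Exchange T i j k l T' = ∀ a b →
  TEdge T' a b ⇔ ((TEdge T a b × ¬ (a ≡ i × b ≡ j)) ⊎ (a ≡ k × b ≡ l))

record DiagonalFlip {n : ℕ} (T T' : Triangulation n) : Set where
  field
    i j k l  : Fin (2 + n)
    i<j      : i < j
    j<k      : j < k
    k<l      : k < l
    edge-ij  : TEdge T i j
    edge-jk  : TEdge T j k
    edge-kl  : TEdge T k l
    edge-il  : TEdge T i l
    exchange : (TEdge T i k × Exchange T i k j l T') ⊎
               (TEdge T j l × Exchange T j l i k T')

InSection : ∀ {n} → Matching n → (p q a b : Fin (2 * n)) → Set
InSection M p q a b = Arc M a b × p ≤ a × b ≤ q

-- M' is obtained from M by the merge for its arc α = pq.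
record Merge {n : ℕ} (M : Matching n) (p q : Fin (2 * n)) (M' : Matching n) : Set where
  field
    α      : Arc M p q
    p>2    : label p ℕ.> 2
    i r    : Fin (2 * n)
    r+1≡p  : suc (label r) ≡ label p
    β      : Arc M i r
    result : ∀ a b → Arc M' a b ⇔
      ( (∃₂ λ c d → InSection M i r c d × label a ≡ suc (label c) × label b ≡ suc (label d))
      ⊎ (a ≡ i × b ≡ q)
      ⊎ (Arc M a b × ¬ InSection M i r a b × ¬ (a ≡ p × b ≡ q)))

-- M' is obtained from M by the split of its arc α = pq from the section of β = sr.
record Split {n : ℕ} (M : Matching n) (p q : Fin (2 * n)) (M' : Matching n) : Set where
  field
    α      : Arc M p q
    p>1    : label p ℕ.> 1
    s r    : Fin (2 * n)
    s+1≡p  : suc (label s) ≡ label p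
    β      : Arc M s r
    result : ∀ a b → Arc M' a b ⇔
      ( (∃₂ λ c d → InSection M p q c d × suc (label a) ≡ label c × suc (label b) ≡ label d)
      ⊎ (a ≡ q × b ≡ r)
      ⊎ (Arc M a b × ¬ InSection M p q a b × ¬ (a ≡ s × b ≡ r)))

{-# OPTIONS --safe #-}
-- A binary tree describes both objects: its subtrees are the sides of a triangulation,
-- split at the apex of the triangle below them, and its inner nodes are the arcs of a
-- matching, split into what is under and what is after the arc.  The 1 that opens an
-- arc and the corresponding non-short side are the same symbol of the Dyck word, so
-- corresponding M and T have the same tree.  Flipping a diagonal is a rotation
-- ((a b) c) ⇝ (a (b c)) or its inverse.  In the word, 1 (1 a 0 b) 0 c becomes
-- 1 a 0 1 b 0 c: the section 1 a 0 of α moves one place to the left, which is a split;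
-- the inverse rotation is a merge.
module Submission where

open import Defs
open import Data.Fin.Base using (Fin; zero; suc; toℕ; fromℕ<; inject₁)
open import Data.Fin.Properties using (toℕ<n; toℕ-injective; toℕ-inject₁; toℕ-fromℕ<)
open import Data.Fin.Subset using (Subset; inside; outside; ⁅_⁆; _∈_; _∉_; _-_; ∣_∣)
open import Data.Fin.Subset.Properties using (_∈?_; Empty-unique; ∣⊥∣≡0; p─⊥≡p; p─q⊆p; p─q─q≡p─q;
  x∈p∧x≢y⇒x∈p-y; x∈p⇒∣p-x∣<∣p∣)
open import Data.Nat.Base using (ℕ; zero; suc; _+_; _*_; _≤_; _<_; _≥_; _>_; z≤n; s≤s)
open import Data.Nat.Properties
open import Data.Nat.Solver using (module +-*-Solver)
open import Data.Product.Base using (_×_; _,_; proj₁; proj₂; ∃; ∃₂; map₁)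
open import Data.Sum.Base as Sum using (_⊎_; inj₁; inj₂)
open import Data.Vec.Base using (Vec; []; _∷_; here; there; tabulate)
open import Function.Base using (_∘_; id; flip; case_of_)
open import Function.Construct.Composition using (_⇔-∘_)
open import Function.Construct.Symmetry using (⇔-sym)
open import Function.Bundles using (_⇔_; mk⇔; module Equivalence)
open import Relation.Binary.PropositionalEquality
open import Relation.Binary.Definitions using (tri<; tri≈; tri>)
open import Relation.Nullary.Decidable using (map′)
open import Relation.Nullary using (¬_; Dec; yes; no; contradiction)

open +-*-Solver using (solve; _:+_; _:*_; _:=_; con)
open Equivalence using (to; from)

-- `Corresponds` only equates two sequences; it provides no map between matchings and
-- triangulations. So a tree is extracted from `T` and from `M` independently, and the two are equal
-- because the block lengths determine a Dyck word. After a flip, split or merge the rotated tree is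
-- known for one of the two new objects only, and the same uniqueness carries it over to the other.
-- Why one tree yields one sequence: a tree on the points i, ..., m has m - i - 1 inner nodes, hence
-- as many 0s in its word, and the 0 that closes the arc above it makes m - i. A subtree starting at
-- the point m is thus read after m - i zeros, and the 1s of that block are the non-short sides that
-- leave m. Points and positions are indices of one type because a rotation treats them differently:
-- it fixes all points, but shifts the positions of one subtree by one.

variable
  a b c d i j k l m w x y z : ℕ

-- A tree in Tree i j x y triangulates the polygon on the points i, …, j and matches the
-- positions x, …, y − 1.  Its root is the side ij and, unless it is a leaf, an arc
-- starting at x.
data Tree : (i j x y : ℕ) → Set where
  leaf : Tree i (suc i) x x
  node : Tree i m (suc x) y → Tree m j (suc y) z → Tree i j x z

data Side : Tree i j x y → ℕ → ℕ → Set where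
  root : {t : Tree i j x y} → Side t i j
  inl  : {l : Tree i m (suc x) y} {r : Tree m j (suc y) z} →
         Side l a b → Side (node l r) a b
  inr  : {l : Tree i m (suc x) y} {r : Tree m j (suc y) z} →
         Side r a b → Side (node l r) a b

data ArcOf : Tree i j x y → ℕ → ℕ → Set where
  root : {l : Tree i m (suc x) y} {r : Tree m j (suc y) z} → ArcOf (node l r) x y
  inl  : {l : Tree i m (suc x) y} {r : Tree m j (suc y) z} →
         ArcOf l a b → ArcOf (node l r) a b
  inr  : {l : Tree i m (suc x) y} {r : Tree m j (suc y) z} →
         ArcOf r a b → ArcOf (node l r) a b

-- Bounds on the sides and arcs of a tree

tree-< : Tree i j x y → i < j
tree-< leaf       = n<1+n _
tree-< (node l r) = <-trans (tree-< l) (tree-< r)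

tree-≤ : Tree i j x y → x ≤ y
tree-≤ leaf       = ≤-refl
tree-≤ (node l r) = ≤-trans (<⇒≤ (tree-≤ l)) (<⇒≤ (tree-≤ r))

side-< : {t : Tree i j x y} → Side t a b → a < b
side-< (root {t = t}) = tree-< t
side-< (inl s)        = side-< s
side-< (inr s)        = side-< s

side-lb : {t : Tree i j x y} → Side t a b → i ≤ a
side-lb root            = ≤-refl
side-lb (inl s)         = side-lb s
side-lb (inr {l = l} s) = ≤-trans (<⇒≤ (tree-< l)) (side-lb s)

side-ub : {t : Tree i j x y} → Side t a b → b ≤ j
side-ub root            = ≤-refl
side-ub (inl {r = r} s) = ≤-trans (side-ub s) (<⇒≤ (tree-< r))
side-ub (inr s)         = side-ub s

arc-< : {t : Tree i j x y} → ArcOf t a b → a < b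
arc-< (root {l = l}) = tree-≤ l
arc-< (inl s)        = arc-< s
arc-< (inr s)        = arc-< s

arc-lb : {t : Tree i j x y} → ArcOf t a b → x ≤ a
arc-lb root            = ≤-refl
arc-lb (inl s)         = <⇒≤ (arc-lb s)
arc-lb (inr {l = l} s) = ≤-trans (<⇒≤ (tree-≤ l)) (<⇒≤ (arc-lb s))

arc-ub : {t : Tree i j x y} → ArcOf t a b → b < y
arc-ub (root {r = r})  = tree-≤ r
arc-ub (inl {r = r} s) = ≤-trans (arc-ub s) (<⇒≤ (tree-≤ r))
arc-ub (inr s)         = arc-ub s

inl⁻ : {l : Tree i m (suc x) y} {r : Tree m j (suc y) z} →
       Side (node l r) a b → b ≤ m → Side l a b
inl⁻ {r = r} root b≤m = contradiction b≤m (<⇒≱ (tree-< r))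
inl⁻ (inl s)      b≤m = s
inl⁻ (inr s)      b≤m = contradiction (≤-trans (side-< s) b≤m) (≤⇒≯ (side-lb s))

inr⁻ : {l : Tree i m (suc x) y} {r : Tree m j (suc y) z} →
       Side (node l r) a b → m ≤ a → Side r a b
inr⁻ {l = l} root m≤a = contradiction m≤a (<⇒≱ (tree-< l))
inr⁻ (inl s)      m≤a = contradiction (≤-trans (s≤s m≤a) (side-< s)) (≤⇒≯ (side-ub s))
inr⁻ (inr s)      m≤a = s

-- The side `ik` can only lie in the left subtree and `kj` only in the right one, which bounds `k`
-- by `m` from both sides. This is how the shape of a tree is recovered from the sides of a
-- quadrilateral.
apex-unique : {l : Tree i m (suc x) y} {r : Tree m j (suc y) z} →
              Side (node l r) i k → Side (node l r) k j → m ≡ k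
apex-unique root            u       = contradiction (side-< u) (<-irrefl refl)
apex-unique (inl s)         root    = contradiction (side-< s) (<-irrefl refl)
apex-unique (inl s) (inl {r = r} u) = contradiction (side-ub u) (<⇒≱ (tree-< r))
apex-unique (inl s)         (inr u) = ≤-antisym (side-lb u) (side-ub s)
apex-unique (inr {l = l} s) u       = contradiction (side-lb s) (<⇒≱ (tree-< l))

sides-noncrossing : {t : Tree i j x y} → Side t a b → Side t c d → a < c → c < b → ¬ b < d
sides-noncrossing root    s₂      a<c c<b b<d = <⇒≱ b<d (side-ub s₂)
sides-noncrossing s₁@(inl _) root a<c c<b b<d = <⇒≱ a<c (side-lb s₁)
sides-noncrossing s₁@(inr _) root a<c c<b b<d = <⇒≱ a<c (side-lb s₁)
sides-noncrossing (inl s) (inl u) a<c c<b b<d = sides-noncrossing s u a<c c<b b<d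
sides-noncrossing (inl s) (inr u) a<c c<b b<d = <⇒≱ c<b (≤-trans (side-ub s) (side-lb u))
sides-noncrossing (inr s) (inl u) a<c c<b b<d =
  <⇒≱ (<-trans a<c (side-< u)) (≤-trans (side-ub u) (side-lb s))
sides-noncrossing (inr s) (inr u) a<c c<b b<d = sides-noncrossing s u a<c c<b b<d

-- Rotations and the sides and arcs they change

raise : Tree i j x y → Tree i j (suc x) (suc y)
raise leaf       = leaf
raise (node l r) = node (raise l) (raise r)

-- A view instead of an inverse function: matching on `lower p` replaces `p` by `raise p′` and
-- exposes its end position as a successor, so that `here` of `Rot` applies without transport along
-- an equation of trees.
data Raised : Tree i j (suc x) y → Set where
  raised : (t : Tree i j x y) → Raised (raise t)

lower : (t : Tree i j (suc x) y) → Raised t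
lower leaf = raised leaf
lower (node l r) with lower l
... | raised l′ with lower r
...   | raised r′ = raised (node l′ r′)

raise-side : {t : Tree i j x y} → Side t a b → Side (raise t) a b
raise-side root    = root
raise-side (inl s) = inl (raise-side s)
raise-side (inr s) = inr (raise-side s)

raise-side⁻ : (t : Tree i j x y) → Side (raise t) a b → Side t a b
raise-side⁻ leaf       root    = root
raise-side⁻ (node l r) root    = root
raise-side⁻ (node l r) (inl s) = inl (raise-side⁻ l s)
raise-side⁻ (node l r) (inr s) = inr (raise-side⁻ r s)

raise-arc : {t : Tree i j x y} → ArcOf t a b → ArcOf (raise t) (suc a) (suc b)
raise-arc root    = root
raise-arc (inl s) = inl (raise-arc s)
raise-arc (inr s) = inr (raise-arc s)

raise-arc⁻ : (t : Tree i j x y) → ArcOf (raise t) a b →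
             ∃₂ λ c d → a ≡ suc c × b ≡ suc d × ArcOf t c d
raise-arc⁻ (node l r) root = _ , _ , refl , refl , root
raise-arc⁻ (node l r) (inl s) with c , d , e , f , u ← raise-arc⁻ l s = c , d , e , f , inl u
raise-arc⁻ (node l r) (inr s) with c , d , e , f , u ← raise-arc⁻ r s = c , d , e , f , inr u

-- The diagonal ik of the quadrilateral ijkl is exchanged for jl.  The arc (x , z) is β
-- and (x + 1 , y + 1) is α; they become (y + 1 , z) and (x , y).
data Rot : (i j k l x y z : ℕ) → Tree a b c d → Tree a b c d → Set where
  here : {p : Tree i j (suc x) y} {q : Tree j k (suc (suc y)) z} {r : Tree k l (suc z) w} →
         Rot i j k l x y z (node (node (raise p) q) r) (node p (node q r))
  inl  : {t t′ : Tree a m (suc c) w} {r : Tree m b (suc w) d} →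
         Rot i j k l x y z t t′ → Rot i j k l x y z (node t r) (node t′ r)
  inr  : {t t′ : Tree m b (suc w) d} {r : Tree a m (suc c) w} →
         Rot i j k l x y z t t′ → Rot i j k l x y z (node r t) (node r t′)

module _ where
  private variable t t′ : Tree a b c d

  rot-sides : Rot i j k l x y z t t′ → Side t a b → Side t′ a b ⊎ (a ≡ i × b ≡ k)
  rot-sides here                root          = inj₁ root
  rot-sides here                (inl root)    = inj₂ (refl , refl)
  rot-sides (here {p = p})      (inl (inl s)) = inj₁ (inl (raise-side⁻ p s))
  rot-sides here                (inl (inr s)) = inj₁ (inr (inl s))
  rot-sides here                (inr s)       = inj₁ (inr (inr s))
  rot-sides (inl ρ)             root          = inj₁ root
  rot-sides (inl ρ)             (inl s)       = Sum.map₁ inl (rot-sides ρ s)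
  rot-sides (inl ρ)             (inr s)       = inj₁ (inr s)
  rot-sides (inr ρ)             root          = inj₁ root
  rot-sides (inr ρ)             (inl s)       = inj₁ (inl s)
  rot-sides (inr ρ)             (inr s)       = Sum.map₁ inr (rot-sides ρ s)

  rot-sides⁻ : Rot i j k l x y z t t′ → Side t′ a b → Side t a b ⊎ (a ≡ j × b ≡ l)
  rot-sides⁻ here    root          = inj₁ root
  rot-sides⁻ here    (inl s)       = inj₁ (inl (inl (raise-side s)))
  rot-sides⁻ here    (inr root)    = inj₂ (refl , refl)
  rot-sides⁻ here    (inr (inl s)) = inj₁ (inl (inr s))
  rot-sides⁻ here    (inr (inr s)) = inj₁ (inr s)
  rot-sides⁻ (inl ρ) root          = inj₁ root
  rot-sides⁻ (inl ρ) (inl s)       = Sum.map₁ inl (rot-sides⁻ ρ s)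
  rot-sides⁻ (inl ρ) (inr s)       = inj₁ (inr s)
  rot-sides⁻ (inr ρ) root          = inj₁ root
  rot-sides⁻ (inr ρ) (inl s)       = inj₁ (inl s)
  rot-sides⁻ (inr ρ) (inr s)       = Sum.map₁ inr (rot-sides⁻ ρ s)

  Quadrilateral : Tree a b c d → (i j k l : ℕ) → Set
  Quadrilateral t i j k l = Side t i j × Side t j k × Side t k l × Side t i l

  rot-quadrilateral : Rot i j k l x y z t t′ → Quadrilateral t i j k l × Side t i k
  rot-quadrilateral here = (inl (inl root) , inl (inr root) , inr root , root) , inl root
  rot-quadrilateral (inl ρ) with (s₁ , s₂ , s₃ , s₄) , s₅ ← rot-quadrilateral ρ =
    (inl s₁ , inl s₂ , inl s₃ , inl s₄) , inl s₅
  rot-quadrilateral (inr ρ) with (s₁ , s₂ , s₃ , s₄) , s₅ ← rot-quadrilateral ρ =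
    (inr s₁ , inr s₂ , inr s₃ , inr s₄) , inr s₅

  rot-quadrilateral⁻ : Rot i j k l x y z t t′ → Quadrilateral t′ i j k l × Side t′ j l
  rot-quadrilateral⁻ here = (inl root , inr (inl root) , inr (inr root) , root) , inr root
  rot-quadrilateral⁻ (inl ρ) with (s₁ , s₂ , s₃ , s₄) , s₅ ← rot-quadrilateral⁻ ρ =
    (inl s₁ , inl s₂ , inl s₃ , inl s₄) , inl s₅
  rot-quadrilateral⁻ (inr ρ) with (s₁ , s₂ , s₃ , s₄) , s₅ ← rot-quadrilateral⁻ ρ =
    (inr s₁ , inr s₂ , inr s₃ , inr s₄) , inr s₅

  -- Beyond the two inclusions of sides, the point is that `ik` has really disappeared: in `t′` it
  -- would cross `jl`.
  rot-exchange : Rot i j k l x y z t t′ → ∀ a b →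
                 Side t′ a b ⇔ ((Side t a b × ¬ (a ≡ i × b ≡ k)) ⊎ (a ≡ j × b ≡ l))
  rot-exchange ρ a b = mk⇔
    (λ s → Sum.map₁ (_, λ { (refl , refl) → sides-noncrossing s jl (side-< ij) (side-< jk) (side-< kl) })
                    (rot-sides⁻ ρ s))
    λ { (inj₁ (s , ≢ik)) → Sum.[ id , (λ ik → contradiction ik ≢ik) ] (rot-sides ρ s)
      ; (inj₂ (refl , refl)) → jl }
    where
    jl = proj₂ (rot-quadrilateral⁻ ρ)
    ij = proj₁ (proj₁ (rot-quadrilateral⁻ ρ))
    jk = proj₁ (proj₂ (proj₁ (rot-quadrilateral⁻ ρ)))
    kl = proj₁ (proj₂ (proj₂ (proj₁ (rot-quadrilateral⁻ ρ))))

  rot-exchange⁻ : Rot i j k l x y z t t′ → ∀ a b →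
                  Side t a b ⇔ ((Side t′ a b × ¬ (a ≡ j × b ≡ l)) ⊎ (a ≡ i × b ≡ k))
  rot-exchange⁻ ρ a b = mk⇔
    (λ s → Sum.map₁ (_, λ { (refl , refl) → sides-noncrossing ik s (side-< ij) (side-< jk) (side-< kl) })
                    (rot-sides ρ s))
    λ { (inj₁ (s , ≢jl)) → Sum.[ id , (λ jl → contradiction jl ≢jl) ] (rot-sides⁻ ρ s)
      ; (inj₂ (refl , refl)) → ik }
    where
    ik = proj₂ (rot-quadrilateral ρ)
    ij = proj₁ (proj₁ (rot-quadrilateral ρ))
    jk = proj₁ (proj₂ (proj₁ (rot-quadrilateral ρ)))
    kl = proj₁ (proj₂ (proj₂ (proj₁ (rot-quadrilateral ρ))))

  -- The side `il` selects the node: the descent stops when it is the root. There `ik` and `kl`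
  -- force the apex to be `k`, and `ij` and `jk` force the apex of the left subtree to be `j`, which
  -- is the shape that `here` rotates.
  rotateʳ : (t : Tree a b c d) → Quadrilateral t i j k l → Side t i k →
            ∃ λ x → ∃₂ λ y z → ∃ λ t′ → Rot i j k l x y z t t′
  rotateʳ leaf (_ , _ , s₃ , root) s₅ = contradiction (side-< s₃) (≤⇒≯ (side-< s₅))
  rotateʳ (node u v) (s₁ , s₂ , s₃ , root) s₅ with apex-unique s₅ s₃
  ... | refl with u | inl⁻ s₁ (<⇒≤ (side-< s₂)) | inl⁻ s₂ ≤-refl
  ...   | leaf     | u₁ | u₂ = contradiction (side-< u₂) (≤⇒≯ (side-< u₁))
  ...   | node p q | u₁ | u₂ with apex-unique u₁ u₂ | lower p
  ...     | refl | raised p′ = _ , _ , _ , _ , here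
  rotateʳ (node u v) (s₁ , s₂ , s₃ , inl s₄) s₅
    with l≤m ← side-ub s₄
    with k≤m ← ≤-trans (<⇒≤ (side-< s₃)) l≤m
    with _ , _ , _ , _ , ρ ← rotateʳ u (inl⁻ s₁ (≤-trans (<⇒≤ (side-< s₂)) k≤m) , inl⁻ s₂ k≤m ,
                                        inl⁻ s₃ l≤m , s₄) (inl⁻ s₅ k≤m)
    = _ , _ , _ , _ , inl ρ
  rotateʳ (node u v) (s₁ , s₂ , s₃ , inr s₄) s₅
    with m≤i ← side-lb s₄
    with m≤j ← ≤-trans m≤i (<⇒≤ (side-< s₁))
    with _ , _ , _ , _ , ρ ← rotateʳ v (inr⁻ s₁ m≤i , inr⁻ s₂ m≤j ,
                                        inr⁻ s₃ (≤-trans m≤j (<⇒≤ (side-< s₂))) , s₄) (inr⁻ s₅ m≤i)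
    = _ , _ , _ , _ , inr ρ

  rotateˡ : (t′ : Tree a b c d) → Quadrilateral t′ i j k l → Side t′ j l →
            ∃ λ x → ∃₂ λ y z → ∃ λ t → Rot i j k l x y z t t′
  rotateˡ leaf (s₁ , _ , _ , root) s₅ = contradiction (side-< s₅) (≤⇒≯ (side-< s₁))
  rotateˡ (node u v) (s₁ , s₂ , s₃ , root) s₅ with apex-unique s₁ s₅
  ... | refl with v | inr⁻ s₂ ≤-refl | inr⁻ s₃ (<⇒≤ (side-< s₂))
  ...   | leaf     | u₂ | u₃ = contradiction (side-< u₃) (≤⇒≯ (side-< u₂))
  ...   | node q r | u₂ | u₃ with apex-unique u₂ u₃
  ...     | refl = _ , _ , _ , _ , here
  rotateˡ (node u v) (s₁ , s₂ , s₃ , inl s₄) s₅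
    with l≤m ← side-ub s₄
    with k≤m ← ≤-trans (<⇒≤ (side-< s₃)) l≤m
    with _ , _ , _ , _ , ρ ← rotateˡ u (inl⁻ s₁ (≤-trans (<⇒≤ (side-< s₂)) k≤m) , inl⁻ s₂ k≤m ,
                                        inl⁻ s₃ l≤m , s₄) (inl⁻ s₅ l≤m)
    = _ , _ , _ , _ , inl ρ
  rotateˡ (node u v) (s₁ , s₂ , s₃ , inr s₄) s₅
    with m≤i ← side-lb s₄
    with m≤j ← ≤-trans m≤i (<⇒≤ (side-< s₁))
    with _ , _ , _ , _ , ρ ← rotateˡ v (inr⁻ s₁ m≤i , inr⁻ s₂ m≤j ,
                                        inr⁻ s₃ (≤-trans m≤j (<⇒≤ (side-< s₂))) , s₄) (inr⁻ s₅ m≤j)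
    = _ , _ , _ , _ , inr ρ

  -- The effect of a rotation on arcs

  rot-β : Rot i j k l x y z t t′ → ArcOf t x z
  rot-β here    = root
  rot-β (inl ρ) = inl (rot-β ρ)
  rot-β (inr ρ) = inr (rot-β ρ)

  rot-α : Rot i j k l x y z t t′ → ArcOf t (suc x) (suc y)
  rot-α here    = inl root
  rot-α (inl ρ) = inl (rot-α ρ)
  rot-α (inr ρ) = inr (rot-α ρ)

  rot-β⁻ : Rot i j k l x y z t t′ → ArcOf t′ x y
  rot-β⁻ here    = root
  rot-β⁻ (inl ρ) = inl (rot-β⁻ ρ)
  rot-β⁻ (inr ρ) = inr (rot-β⁻ ρ)

  rot-α⁻ : Rot i j k l x y z t t′ → ArcOf t′ (suc y) z
  rot-α⁻ here    = inr root
  rot-α⁻ (inl ρ) = inl (rot-α⁻ ρ)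
  rot-α⁻ (inr ρ) = inr (rot-α⁻ ρ)

  -- The start of an arc that is neither β nor in the section of α.
  Away : (x y a : ℕ) → Set
  Away x y a = a < x ⊎ suc y < a

  -- Where an arc of `t` comes from in `t′`. Unmoved arcs carry the inequality `Away` and not the
  -- negations found in `Split` and `Merge`: an inequality is easily established at each level of
  -- the recursion, and both negations follow from it at the end.
  ArcImage : (x y z : ℕ) (t′ : Tree a b c d) → ℕ → ℕ → Set
  ArcImage x y z t′ a b =
    (∃₂ λ c d → a ≡ suc c × b ≡ suc d × ArcOf t′ c d × x ≤ c × d ≤ y)
    ⊎ (a ≡ x × b ≡ z)
    ⊎ (ArcOf t′ a b × Away x y a)

  ArcImage⁻ : (x y z : ℕ) (t : Tree a b c d) → ℕ → ℕ → Set
  ArcImage⁻ x y z t a b =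
    (ArcOf t (suc a) (suc b) × x ≤ a × b ≤ y)
    ⊎ (a ≡ suc y × b ≡ z)
    ⊎ (ArcOf t a b × Away x y a)

  ArcImage-map : {t : Tree a b c d} {t′ : Tree i j k l} →
                 (∀ {a b} → ArcOf t a b → ArcOf t′ a b) →
                 ∀ {a b} → ArcImage x y z t a b → ArcImage x y z t′ a b
  ArcImage-map f = Sum.map (λ { (c , d , e , e′ , s , h) → c , d , e , e′ , f s , h })
                           (Sum.map₂ (map₁ f))

  ArcImage⁻-map : {t : Tree a b c d} {t′ : Tree i j k l} →
                  (∀ {a b} → ArcOf t a b → ArcOf t′ a b) →
                  ∀ {a b} → ArcImage⁻ x y z t a b → ArcImage⁻ x y z t′ a b
  ArcImage⁻-map f = Sum.map (map₁ f) (Sum.map₂ (map₁ f))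

  rot-x<y : Rot i j k l x y z t t′ → x < y
  rot-x<y ρ = arc-< (rot-β⁻ ρ)

  rot-arcs : Rot i j k l x y z t t′ → ArcOf t a b → ArcImage x y z t′ a b
  rot-arcs here root       = inj₂ (inj₁ (refl , refl))
  rot-arcs here (inl root) = inj₁ (_ , _ , refl , refl , root , ≤-refl , ≤-refl)
  rot-arcs (here {p = p}) (inl (inl s)) with _ , _ , refl , refl , u ← raise-arc⁻ p s =
    inj₁ (_ , _ , refl , refl , inl u , <⇒≤ (arc-lb u) , <⇒≤ (arc-ub u))
  rot-arcs here (inl (inr s)) = inj₂ (inj₂ (inr (inl s) , inj₂ (arc-lb s)))
  rot-arcs (here {q = q}) (inr s) =
    inj₂ (inj₂ (inr (inr s) , inj₂ (≤-trans (tree-≤ q) (<⇒≤ (arc-lb s)))))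
  rot-arcs (inl ρ) root    = inj₂ (inj₂ (root , inj₁ (arc-lb (rot-β ρ))))
  rot-arcs (inl ρ) (inl s) = ArcImage-map inl (rot-arcs ρ s)
  rot-arcs (inl ρ) (inr s) =
    inj₂ (inj₂ (inr s , inj₂ (<-trans (arc-ub (rot-α ρ)) (arc-lb s))))
  rot-arcs (inr {r = l} ρ) root =
    inj₂ (inj₂ (root , inj₁ (≤-trans (tree-≤ l) (<⇒≤ (arc-lb (rot-β ρ))))))
  rot-arcs (inr ρ) (inl s) =
    inj₂ (inj₂ (inl s , inj₁ (<-trans (arc-< s) (<-trans (arc-ub s) (arc-lb (rot-β ρ))))))
  rot-arcs (inr ρ) (inr s) = ArcImage-map inr (rot-arcs ρ s)

  rot-arcs⁻ : Rot i j k l x y z t t′ → ArcOf t′ a b → ArcImage⁻ x y z t a b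
  rot-arcs⁻ here root    = inj₁ (inl root , ≤-refl , ≤-refl)
  rot-arcs⁻ here (inl s) = inj₁ (inl (inl (raise-arc s)) , <⇒≤ (arc-lb s) , <⇒≤ (arc-ub s))
  rot-arcs⁻ here (inr root)    = inj₂ (inj₁ (refl , refl))
  rot-arcs⁻ here (inr (inl s)) = inj₂ (inj₂ (inl (inr s) , inj₂ (arc-lb s)))
  rot-arcs⁻ (here {q = q}) (inr (inr s)) =
    inj₂ (inj₂ (inr s , inj₂ (≤-trans (tree-≤ q) (<⇒≤ (arc-lb s)))))
  rot-arcs⁻ (inl ρ) root    = inj₂ (inj₂ (root , inj₁ (arc-lb (rot-β ρ))))
  rot-arcs⁻ (inl ρ) (inl s) = ArcImage⁻-map inl (rot-arcs⁻ ρ s)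
  rot-arcs⁻ (inl ρ) (inr s) =
    inj₂ (inj₂ (inr s , inj₂ (<-trans (arc-ub (rot-α ρ)) (arc-lb s))))
  rot-arcs⁻ (inr {r = l} ρ) root =
    inj₂ (inj₂ (root , inj₁ (≤-trans (tree-≤ l) (<⇒≤ (arc-lb (rot-β ρ))))))
  rot-arcs⁻ (inr ρ) (inl s) =
    inj₂ (inj₂ (inl s , inj₁ (<-trans (arc-< s) (<-trans (arc-ub s) (arc-lb (rot-β ρ))))))
  rot-arcs⁻ (inr ρ) (inr s) = ArcImage⁻-map inr (rot-arcs⁻ ρ s)

  Section : Tree a b c d → (p q : ℕ) → ℕ → ℕ → Set
  Section t p q a b = ArcOf t a b × p ≤ a × b ≤ q

  SplitArc : Tree a b c d → (p q s r : ℕ) → ℕ → ℕ → Set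
  SplitArc t p q s r a b =
    (∃₂ λ c d → Section t p q c d × suc a ≡ c × suc b ≡ d)
    ⊎ (a ≡ q × b ≡ r)
    ⊎ (ArcOf t a b × ¬ Section t p q a b × ¬ (a ≡ s × b ≡ r))

  MergeArc : Tree a b c d → (p q i r : ℕ) → ℕ → ℕ → Set
  MergeArc t p q i r a b =
    (∃₂ λ c d → Section t i r c d × a ≡ suc c × b ≡ suc d)
    ⊎ (a ≡ i × b ≡ q)
    ⊎ (ArcOf t a b × ¬ Section t i r a b × ¬ (a ≡ p × b ≡ q))

  -- `rot-arcs⁻` gives one direction and `rot-arcs` the other. An arc that is `Away` starts before
  -- both β and the section of α, or after the end of that section; this yields the two negations,
  -- and conversely rules out the cases that do not match.
  rot-split : Rot i j k l x y z t t′ → ∀ a b →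
              ArcOf t′ a b ⇔ SplitArc t (suc x) (suc y) x z a b
  rot-split {x = x} {y = y} {z = z} {t = t} {t′ = t′} ρ a b = mk⇔ split unsplit
    where
    split : ArcOf t′ a b → SplitArc t (suc x) (suc y) x z a b
    split s with rot-arcs⁻ ρ s
    ... | inj₁ (u , x≤a , b≤y)       = inj₁ (_ , _ , (u , s≤s x≤a , s≤s b≤y) , refl , refl)
    ... | inj₂ (inj₁ e)              = inj₂ (inj₁ e)
    ... | inj₂ (inj₂ (u , inj₁ a<x)) =
      inj₂ (inj₂ (u , (λ (_ , x<a , _) → <-asym a<x x<a) , λ { (refl , _) → <-irrefl refl a<x }))
    ... | inj₂ (inj₂ (u , inj₂ y<a)) =
      inj₂ (inj₂ (u , (λ (_ , _ , b≤y) → <⇒≱ (<-trans y<a (arc-< u)) b≤y)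
                    , λ { (refl , _) → <⇒≱ y<a (<⇒≤ (m<n⇒m<1+n (rot-x<y ρ))) }))
    unsplit : SplitArc t (suc x) (suc y) x z a b → ArcOf t′ a b
    unsplit (inj₁ (_ , _ , (s , x<c , d≤y) , refl , refl)) with rot-arcs ρ s
    ... | inj₁ (_ , _ , refl , refl , u , _) = u
    ... | inj₂ (inj₁ (refl , _))             = contradiction x<c (<-irrefl refl)
    ... | inj₂ (inj₂ (u , inj₁ c<x))         = contradiction c<x (<-asym x<c)
    ... | inj₂ (inj₂ (u , inj₂ y<c))         = contradiction d≤y (<⇒≱ (<-trans y<c (arc-< u)))
    unsplit (inj₂ (inj₁ (refl , refl))) = rot-α⁻ ρ
    unsplit (inj₂ (inj₂ (s , ∉αs , ≢β))) with rot-arcs ρ s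
    ... | inj₁ (_ , _ , refl , refl , u , x≤c , d≤y) = contradiction (s , s≤s x≤c , s≤s d≤y) ∉αs
    ... | inj₂ (inj₁ e)                              = contradiction e ≢β
    ... | inj₂ (inj₂ (u , _))                        = u

  rot-merge : Rot i j k l x y z t t′ → ∀ a b →
              ArcOf t a b ⇔ MergeArc t′ (suc y) z x y a b
  rot-merge {x = x} {y = y} {z = z} {t = t} {t′ = t′} ρ a b = mk⇔ merge unmerge
    where
    merge : ArcOf t a b → MergeArc t′ (suc y) z x y a b
    merge s with rot-arcs ρ s
    ... | inj₁ (c , d , e , e′ , u)  = inj₁ (c , d , u , e , e′)
    ... | inj₂ (inj₁ e)              = inj₂ (inj₁ e)
    ... | inj₂ (inj₂ (u , inj₁ a<x)) =
      inj₂ (inj₂ (u , (λ (_ , x≤a , _) → <⇒≱ a<x x≤a)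
                    , λ { (refl , _) → <-asym a<x (m<n⇒m<1+n (rot-x<y ρ)) }))
    ... | inj₂ (inj₂ (u , inj₂ y<a)) =
      inj₂ (inj₂ (u , (λ (_ , _ , b≤y) → <⇒≱ (<-trans (<-trans (n<1+n _) y<a) (arc-< u)) b≤y)
                    , λ { (refl , _) → <-irrefl refl y<a }))
    unmerge : MergeArc t′ (suc y) z x y a b → ArcOf t a b
    unmerge (inj₁ (_ , _ , (s , x≤c , d≤y) , refl , refl)) with rot-arcs⁻ ρ s
    ... | inj₁ (u , _)               = u
    ... | inj₂ (inj₁ (refl , refl))  = contradiction (arc-< (rot-α⁻ ρ)) (≤⇒≯ (m≤n⇒m≤1+n d≤y))
    ... | inj₂ (inj₂ (u , inj₁ c<x)) = contradiction x≤c (<⇒≱ c<x)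
    ... | inj₂ (inj₂ (u , inj₂ y<c)) =
      contradiction d≤y (<⇒≱ (<-trans (<-trans (n<1+n _) y<c) (arc-< u)))
    unmerge (inj₂ (inj₁ (refl , refl))) = rot-β ρ
    unmerge (inj₂ (inj₂ (s , ∉βs , ≢α))) with rot-arcs⁻ ρ s
    ... | inj₁ (_ , h)        = contradiction (s , h) ∉βs
    ... | inj₂ (inj₁ e)       = contradiction e ≢α
    ... | inj₂ (inj₂ (u , _)) = u

  -- Descend to the node of β. What is under β begins at `suc x`, so α is the root there and the
  -- tree has the shape on the left of `here`; anywhere else α would start outside the positions
  -- available. That `w` is a successor comes from `lower p`.
  splitting : (t : Tree a b c d) → ArcOf t (suc x) w → ArcOf t x z →
              ∃₂ λ i j → ∃₂ λ k l → ∃₂ λ y t′ → w ≡ suc y × Rot i j k l x y z t t′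
  splitting (node leaf v) (inr s) root = contradiction (arc-lb s) (<⇒≱ (s≤s (n<1+n _)))
  splitting (node (node p q) v) (inl root) root with raised _ ← lower p =
    _ , _ , _ , _ , _ , _ , refl , here
  splitting (node (node p q) v) (inl (inl s)) root = contradiction (arc-lb s) 1+n≰n
  splitting (node (node p q) v) (inl (inr s)) root =
    contradiction (arc-lb s) (<⇒≱ (m≤n⇒m≤1+n (tree-≤ p)))
  splitting (node (node p q) v) (inr s) root =
    contradiction (arc-lb s) (<⇒≱ (s≤s (tree-≤ (node p q))))
  splitting (node u v) root    (inl s₂) = contradiction (arc-lb s₂) (<⇒≱ (m<n⇒m<1+n (n<1+n _)))
  splitting (node u v) (inl s) (inl s₂)
    with _ , _ , _ , _ , _ , _ , e , ρ ← splitting u s s₂ = _ , _ , _ , _ , _ , _ , e , inl ρ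
  splitting (node u v) (inr s) (inl s₂) =
    contradiction (arc-lb s) (<⇒≱ (s≤s (<-trans (arc-< s₂) (arc-ub s₂))))
  splitting (node u v) root    (inr s₂) =
    contradiction (arc-lb s₂) (<⇒≱ (m≤n⇒m≤1+n (<⇒≤ (tree-≤ u))))
  splitting (node u v) (inl s) (inr s₂) =
    contradiction (arc-lb s₂) (<⇒≱ (<-trans (n<1+n _) (m<n⇒m<1+n (<-trans (arc-< s) (arc-ub s)))))
  splitting (node u v) (inr s) (inr s₂)
    with _ , _ , _ , _ , _ , _ , e , ρ ← splitting v s s₂ = _ , _ , _ , _ , _ , _ , e , inr ρ

  -- Again descend to the node of β; now what comes after β begins at `suc y`, so α is the root of
  -- the right subtree.
  merging : (t′ : Tree a b c d) → ArcOf t′ x y → ArcOf t′ (suc y) z →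
            ∃₂ λ i j → ∃₂ λ k l → ∃ λ t → Rot i j k l x y z t t′
  merging (node u (node q r)) root (inr root) = _ , _ , _ , _ , _ , here
  merging (node u (node q r)) root (inr (inl s)) = contradiction (arc-lb s) 1+n≰n
  merging (node u (node q r)) root (inr (inr s)) =
    contradiction (arc-lb s) (<⇒≱ (m≤n⇒m≤1+n (tree-≤ q)))
  merging (node u v) root    root     = contradiction (tree-≤ u) (<⇒≱ (m<n⇒m<1+n (n<1+n _)))
  merging (node u v) root    (inl s₂) =
    contradiction (<-trans (arc-< s₂) (arc-ub s₂)) (<⇒≱ (m<n⇒m<1+n (n<1+n _)))
  merging (node u v) (inl s) root     =
    contradiction (arc-lb s) (<⇒≱ (m<n⇒m<1+n (m<n⇒m<1+n (arc-< s))))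
  merging (node u v) (inl s) (inl s₂)
    with _ , _ , _ , _ , _ , ρ ← merging u s s₂ = _ , _ , _ , _ , _ , inl ρ
  merging (node u v) (inl s) (inr s₂) = contradiction (arc-lb s₂) (<⇒≱ (s≤s (arc-ub s)))
  merging (node u v) (inr s) root     =
    contradiction (<-trans (tree-≤ u) (arc-lb s))
                  (<⇒≱ (m<n⇒m<1+n (m<n⇒m<1+n (arc-< s))))
  merging (node u v) (inr s) (inl s₂) =
    contradiction (<-trans (<-trans (<-trans (arc-< s₂) (arc-ub s₂)) (arc-lb s)) (arc-< s))
                  (<⇒≱ (m<n⇒m<1+n (n<1+n _)))
  merging (node u v) (inr s) (inr s₂)
    with _ , _ , _ , _ , _ , ρ ← merging v s s₂ = _ , _ , _ , _ , _ , inr ρ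

-- The tree of a triangulation and the tree of a matching

largest : {P : ℕ → Set} → (∀ k → Dec (P k)) → P a → ∀ b → a ≤ b →
          ∃ λ m → a ≤ m × m ≤ b × P m × (∀ {k} → m < k → k ≤ b → ¬ P k)
largest P? pa b a≤b with P? b
... | yes pb = b , a≤b , ≤-refl , pb , λ b<k k≤b → contradiction k≤b (<⇒≱ b<k)
largest P? pa zero    z≤n | no ¬pb = contradiction pa ¬pb
largest P? pa (suc b) a≤b | no ¬pb with m≤n⇒m<n∨m≡n a≤b
... | inj₂ refl = contradiction pa ¬pb
... | inj₁ (s≤s a≤b′) with m , a≤m , m≤b , pm , max ← largest P? pa b a≤b′ =
  m , a≤m , m≤n⇒m≤1+n m≤b , pm , λ m<k k≤1+b → case m≤n⇒m<n∨m≡n k≤1+b of λ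
    { (inj₁ (s≤s k≤b)) → max m<k k≤b ; (inj₂ refl) → ¬pb }

-- Trees are indexed by natural numbers, so edges are moved there as well. Numbers out of range
-- bound no edge, which spares the lemmas about edges most range hypotheses.
Edgeℕ : ∀ {N} → Graph N → ℕ → ℕ → Set
Edgeℕ G a b = ∃₂ λ i j → toℕ i ≡ a × toℕ j ≡ b × Edge G i j

edgeℕ⁻ : ∀ {N} (G : Graph N) {i j} → Edgeℕ G (toℕ i) (toℕ j) → Edge G i j
edgeℕ⁻ G (_ , _ , p , q , e) with refl ← toℕ-injective p | refl ← toℕ-injective q = e

finite : ∀ {N} → a < N → ∃ λ (i : Fin N) → toℕ i ≡ a
finite a<N = fromℕ< a<N , toℕ-fromℕ< a<N

edgeℕ? : ∀ {N} (G : Graph N) a b → Dec (Edgeℕ G a b)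
edgeℕ? {N} G a b with a <? N | b <? N
... | no a≮N  | _ = no λ { (i , _ , refl , _) → a≮N (toℕ<n i) }
... | yes _   | no b≮N = no λ { (_ , j , _ , refl , _) → b≮N (toℕ<n j) }
... | yes a<N | yes b<N with i , refl ← finite a<N | j , refl ← finite b<N =
  map′ (λ e → i , j , refl , refl , e) (edgeℕ⁻ G) (j ∈? G i)

module _ {n} (T : Triangulation n) where
  open Triangulation T

  private
    E = Edgeℕ graph

    E-< : E a b → a < b
    E-< (_ , _ , refl , refl , e) = ascending e

    E-noncrossing : E a b → E c d → a < c → c < b → ¬ b < d
    E-noncrossing (_ , _ , refl , refl , e) (_ , _ , refl , refl , f) a<c c<b b<d =
      nonCrossing e f (inj₁ (a<c , c<b , b<d))

    E-maximal : a < b → b < 2 + n →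
                (∀ {c d} → E c d → a < c → c < b → ¬ b < d) →
                (∀ {c d} → E c d → c < a → a < d → ¬ d < b) → E a b
    E-maximal a<b b<N h₁ h₂ with i , refl ← finite (<-trans a<b b<N) | j , refl ← finite b<N =
      i , j , refl , refl , maximal a<b λ f →
        λ { (inj₁ (p , q , r)) → h₁ (_ , _ , refl , refl , f) p q r
          ; (inj₂ (p , q , r)) → h₂ (_ , _ , refl , refl , f) p q r }

    -- No point lies strictly between the two ends, so nothing crosses the segment and maximality
    -- supplies it. It is the starting value of the search for an apex.
    E-short : suc i < 2 + n → E i (suc i)
    E-short i<N = E-maximal (n<1+n _) i<N
      (λ _ i<c c≤i _ → <⇒≱ (s≤s i<c) c≤i) (λ _ _ i<d d≤i → <⇒≱ (s≤s i<d) d≤i)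

    -- The apex of the triangle below ij is the last neighbour of i before j.
    E-apex : E i j → suc i < j → j < 2 + n →
             ∃ λ m → i < m × m < j × E i m × E m j
    E-apex {i} {suc j} e (s≤s i<j) j<N
      with m , i<m , m≤j , im , max ← largest (edgeℕ? graph i)
             (E-short (<-trans (s≤s i<j) j<N)) j i<j =
      m , i<m , s≤s m≤j , im , E-maximal (s≤s m≤j) j<N
        (λ f m<c c<j j<d → E-noncrossing e f (<-trans i<m m<c) c<j j<d)
        -- Such an edge would cross `ij` if it starts before `i`, cross `im` if it starts after `i`,
        -- and be a later neighbour of `i` than `m` if it starts at `i`.
        λ f c<m m<d d<j → case <-cmp _ i of λ
          { (tri< c<i _ _)  → E-noncrossing f e c<i (<-trans i<m m<d) d<j
          ; (tri≈ _ refl _) → max m<d (≤-pred d<j) f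
          ; (tri> _ _ i<c)  → E-noncrossing im f i<c c<m m<d }

    -- `f` is fuel that bounds `j − i`. The triangulation fixes the points; the start position is
    -- free, and the end position is produced by the recursion, since the right subtree starts just
    -- after the left one ends.
    E-tree : ∀ f → j ≤ f + i → E i j → j < 2 + n → ∀ x →
             ∃₂ λ y (t : Tree i j x y) →
             (∀ {a b} → Side t a b → E a b) ×
             (∀ {a b} → E a b → i ≤ a → b ≤ j → Side t a b)
    E-tree zero    j≤i   e j<N x = contradiction (E-< e) (≤⇒≯ j≤i)
    E-tree (suc f) j≤f+i e j<N x with m≤n⇒m<n∨m≡n (E-< e)
    ... | inj₂ refl = x , leaf , (λ { root → e }) , λ s i≤a b≤j →
      case ≤-antisym i≤a (≤-pred (≤-trans (E-< s) b≤j)) of λ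
        { refl → case ≤-antisym b≤j (E-< s) of λ { refl → root } }
    ... | inj₁ 1+i<j
      with m , i<m , m<j , im , mj ← E-apex e 1+i<j j<N
      with y , l , l→ , l← ← E-tree f (≤-pred (≤-trans m<j j≤f+i)) im (<-trans m<j j<N) (suc x)
      with z , r , r→ , r← ← E-tree f (≤-trans j≤f+i (≤-trans (≤-reflexive (sym (+-suc f _)))
                                                        (+-monoʳ-≤ f i<m))) mj j<N (suc y) =
      z , node l r , (λ { root → e ; (inl s) → l→ s ; (inr s) → r→ s }) , complete
      where
      complete : E a b → _ ≤ a → b ≤ _ → Side (node l r) a b
      complete {a} {b} s i≤a b≤j with b ≤? m
      ... | yes b≤m = inl (l← s i≤a b≤m)
      ... | no b≰m with m ≤? a
      ...   | yes m≤a = inr (r← s m≤a b≤j)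
      -- The edge passes over the apex `m`. It crosses `im` unless it starts at `i`, and then
      -- crosses `mj` unless it ends at `j`.
      ...   | no m≰a with m≤n⇒m<n∨m≡n i≤a
      ...     | inj₁ i<a = contradiction (≰⇒> b≰m) (E-noncrossing im s i<a (≰⇒> m≰a))
      ...     | inj₂ refl with m≤n⇒m<n∨m≡n b≤j
      ...       | inj₁ b<j  = contradiction b<j (E-noncrossing s mj (≰⇒> m≰a) (≰⇒> b≰m))
      ...       | inj₂ refl = root

  Triangulates : Tree i j x y → Set
  Triangulates t = ∀ a b → TEdge T a b ⇔ Side t (toℕ a) (toℕ b)

  triangulation-tree : ∃₂ λ y (t : Tree 0 (suc n) 0 y) → Triangulates t
  triangulation-tree
    with y , t , t→ , t← ← E-tree (suc n) (≤-reflexive (sym (+-identityʳ (suc n))))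
           -- The boundary edge from the first to the last point: a crossing edge would need an
           -- endpoint beyond one of them.
           (E-maximal (s≤s z≤n) ≤-refl (λ { (_ , j , _ , refl , _) _ _ 1+n<d → <⇒≱ (toℕ<n j) 1+n<d })
                      λ _ ())
           ≤-refl 0 =
    y , t , λ a b → mk⇔ (λ e → t← (a , b , refl , refl , e) z≤n (≤-pred (toℕ<n b)))
                        (edgeℕ⁻ graph ∘ t→)

module _ {n} (M : Matching n) where
  open Matching M

  private
    A = Edgeℕ graph

    A-< : A a b → a < b
    A-< (_ , _ , refl , refl , e) = ascending e

    A-noncrossing : A a b → A c d → a < c → c < b → ¬ b < d
    A-noncrossing (_ , _ , refl , refl , e) (_ , _ , refl , refl , f) a<c c<b b<d =
      nonCrossing e f (inj₁ (a<c , c<b , b<d))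

    partner-unique : ∀ {u v w} → Edge graph u v ⊎ Edge graph v u →
                     Edge graph u w ⊎ Edge graph w u → v ≡ w
    partner-unique {u} p q with _ , _ , unique ← perfect u = trans (sym (unique p)) (unique q)

    head-unique : A a b → A a c → b ≡ c
    head-unique (_ , _ , refl , refl , e) (_ , _ , p , refl , f) with refl ← toℕ-injective p =
      cong toℕ (partner-unique (inj₁ e) (inj₁ f))

    tail-unique : A a c → A b c → a ≡ b
    tail-unique (_ , _ , refl , refl , e) (_ , _ , refl , q , f) with refl ← toℕ-injective q =
      cong toℕ (partner-unique (inj₂ e) (inj₂ f))

  -- By uniqueness of the partner of `b` the two neighbours would coincide, yet one precedes `b` and
  -- the other follows it.
  tail≢head : A a b → ¬ A b c
  tail≢head s@(_ , _ , refl , refl , e) u@(_ , _ , p , refl , f) with refl ← toℕ-injective p =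
    <-irrefl (cong toℕ (partner-unique (inj₂ e) (inj₁ f))) (<-trans (A-< s) (A-< u))

  private
    partner : a < 2 * n → ∃ λ b → A a b ⊎ A b a
    partner a<N with v , refl ← finite a<N with w , p , _ ← perfect v =
      toℕ w , Sum.map (λ e → v , w , refl , refl , e) (λ e → w , v , refl , refl , e) p

    -- The positions x, ..., y - 1 are a union of whole arcs. Each half states one bound only; the
    -- other follows from `a < b`.
    Closed : ℕ → ℕ → Set
    Closed x y = ∀ {a b} → A a b → (x ≤ a → a < y → b < y) × (x ≤ b → b < y → x ≤ a)

    module _ (closed : Closed x y) (s : A x w) (x<y : x < y) where
      w<y : w < y
      w<y = proj₁ (closed s) ≤-refl x<y

      tail-> : A a b → x ≤ b → b < y → b ≢ w → x < a
      tail-> u x≤b b<y b≢w with m≤n⇒m<n∨m≡n (proj₂ (closed u) x≤b b<y)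
      ... | inj₁ x<a  = x<a
      ... | inj₂ refl = contradiction (head-unique u s) b≢w

      -- The arc from `x` to `w` cuts a closed interval into two closed ones, this and
      -- `closed-after`: an arc that leaves either part within the interval would cross it or share
      -- an endpoint with it.
      closed-below : Closed (suc x) w
      closed-below {a} {b} u =
        head , λ x<b b<w → tail-> u (<⇒≤ x<b) (<-trans b<w w<y) (<⇒≢ b<w)
        where
        head : x < a → a < w → b < w
        head x<a a<w with <-cmp b w
        ... | tri< b<w _ _  = b<w
        ... | tri≈ _ refl _ = contradiction x<a (<-irrefl (tail-unique s u))
        ... | tri> _ _ w<b  = contradiction w<b (A-noncrossing s u x<a a<w)

      closed-after : Closed (suc w) y
      closed-after {a} {b} u = (λ w<a → proj₁ (closed u) (<⇒≤ (<-trans (A-< s) w<a))) , tail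
        where
        tail : w < b → b < y → w < a
        tail w<b b<y with <-cmp a w
        ... | tri< a<w _ _  = contradiction w<b
          (A-noncrossing s u (tail-> u (<⇒≤ (<-trans (A-< s) w<b)) b<y (>⇒≢ w<b)) a<w)
        ... | tri≈ _ refl _ = contradiction u (tail≢head s)
        ... | tri> _ _ w<a  = w<a

    -- The roles of `E-tree` are interchanged: positions are given and points are produced. An empty
    -- interval still uses up one short side, from `i` to `suc i`.
    A-tree : ∀ f → x ≤ y → y ≤ f + x → y ≤ 2 * n → Closed x y → ∀ i →
             ∃₂ λ j (t : Tree i j x y) →
             (∀ {a b} → ArcOf t a b → A a b) ×
             (∀ {a b} → A a b → x ≤ a → b < y → ArcOf t a b)
    A-tree f x≤y y≤f+x y≤N closed i with m≤n⇒m<n∨m≡n x≤y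
    ... | inj₂ refl = suc i , leaf , (λ ()) , λ s x≤a b<x →
      contradiction (<-trans (A-< s) b<x) (≤⇒≯ x≤a)
    A-tree zero    x≤y y≤x   y≤N closed i | inj₁ x<y = contradiction x<y (≤⇒≯ y≤x)
    A-tree {x} {y} (suc f) x≤y y≤f+x y≤N closed i | inj₁ x<y with partner (≤-trans x<y y≤N)
    -- An arc ending at `x` would start before `x`, against closedness; hence `x` starts an arc.
    ... | _ , inj₂ s = contradiction (A-< s) (≤⇒≯ (proj₂ (closed s) ≤-refl x<y))
    ... | w , inj₁ s
      with w<y ← proj₁ (closed s) ≤-refl x<y
      with m , l , l→ , l← ← A-tree f (A-< s)
             (≤-trans (≤-pred (≤-trans w<y y≤f+x)) (+-monoʳ-≤ f (n≤1+n x)))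
             (≤-trans (<⇒≤ w<y) y≤N) (closed-below closed s x<y) i
      with j , r , r→ , r← ← A-tree f w<y
             (≤-trans y≤f+x (≤-trans (≤-reflexive (sym (+-suc f x)))
                                     (+-monoʳ-≤ f (m≤n⇒m≤1+n (A-< s)))))
             y≤N (closed-after closed s x<y) m =
      j , node l r , (λ { root → s ; (inl u) → l→ u ; (inr u) → r→ u }) , complete
      where
      complete : A a b → x ≤ a → b < y → ArcOf (node l r) a b
      complete {a} u x≤a b<y with m≤n⇒m<n∨m≡n x≤a
      ... | inj₂ refl with refl ← head-unique s u = root
      ... | inj₁ x<a with <-cmp a w
      ...   | tri< a<w _ _  = inl (l← u x<a (proj₁ (closed-below closed s x<y u) x<a a<w))
      ...   | tri≈ _ refl _ = contradiction u (tail≢head s)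
      ...   | tri> _ _ w<a  = inr (r← u w<a b<y)

  Matches : Tree i j x y → Set
  Matches t = ∀ a b → Arc M a b ⇔ ArcOf t (toℕ a) (toℕ b)

  -- The last point stays open; it is identified with `suc n` when the tree is compared with that of
  -- a triangulation.
  matching-tree : ∃₂ λ j (t : Tree 0 j 0 (2 * n)) → Matches t
  matching-tree
    with j , t , t→ , t← ← A-tree (2 * n) z≤n (≤-reflexive (sym (+-identityʳ (2 * n)))) ≤-refl
           (λ { (_ , j , _ , refl , _) → (λ _ _ → toℕ<n j) , λ _ _ → z≤n }) 0 =
    j , t , λ a b → mk⇔ (λ e → t← (a , b , refl , refl , e) z≤n (toℕ<n b)) (edgeℕ⁻ graph ∘ t→)

-- Corresponding objects have the same tree

-- Words are represented by the function counting the 1s in each block: `first` is the contribution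
-- of a leading 1, `0∷_` puts a 0 in front, and `none` is the empty word.
first : ℕ → ℕ
first zero    = 1
first (suc _) = 0

infixr 5 0∷_
0∷_ : (ℕ → ℕ) → ℕ → ℕ
(0∷ f) zero    = 0
(0∷ f) (suc k) = f k

none : ℕ → ℕ
none _ = 0

-- If f k is the number of 1s between the k-th and the (k + 1)-st 0 of a word, then
-- blocks t f gives these numbers for the Dyck word of t followed by that word.
blocks : Tree i j x y → (ℕ → ℕ) → ℕ → ℕ
blocks leaf       f   = f
blocks (node l r) f k = first k + blocks l (0∷ blocks r f) k

0∷-cong : ∀ {f g} → f ≗ g → 0∷ f ≗ 0∷ g
0∷-cong f≗g zero    = refl
0∷-cong f≗g (suc k) = f≗g k

blocks-cong : ∀ (t : Tree i j x y) {f g} → f ≗ g → blocks t f ≗ blocks t g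
blocks-cong leaf       f≗g = f≗g
blocks-cong (node l r) f≗g k =
  cong (first k +_) (blocks-cong l (0∷-cong (blocks-cong r f≗g)) k)

TreeFrom : ℕ → ℕ → Set
TreeFrom i x = ∃₂ λ j y → Tree i j x y

-- Block 0 is empty for a leaf and not for a node, so the first symbol decides. The 0 after the word
-- marks its end: without it, a leaf followed by a 1 would look like a node. The conclusion `f ≗ g`
-- is what the comparison of right subtrees starts from. The equality is in `TreeFrom` because the
-- end indices are not known to agree beforehand.
blocks-injective : ∀ (t : Tree i j x y) (u : Tree i k x z) {f g} →
                   blocks t (0∷ f) ≗ blocks u (0∷ g) →
                   _≡_ {A = TreeFrom i x} (_ , _ , t) (_ , _ , u) × f ≗ g
blocks-injective leaf       leaf         eq = refl , eq ∘ suc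
blocks-injective leaf       (node l r)   eq = contradiction (eq 0) λ ()
blocks-injective (node l r) leaf         eq = contradiction (eq 0) λ ()
blocks-injective (node l r) (node l′ r′) eq
  with refl , eq₁ ← blocks-injective l l′ (λ k → +-cancelˡ-≡ (first k) _ _ (eq k))
  with refl , eq₂ ← blocks-injective r r′ eq₁ = refl , eq₂

beyond : m ≤ a → ∃ λ l → a ≡ l + m
beyond {m} m≤a with l , eq ← m≤n⇒∃[o]m+o≡n m≤a = l , trans (sym eq) (+-comm m l)

first-beyond : i < j → k + i ≡ l + j → first k ≡ 0
first-beyond {k = zero}  {l} i<j refl = contradiction (m≤n+m _ l) (<⇒≱ i<j)
first-beyond {k = suc _} i<j eq       = refl

-- Block `k` belongs to the point `k + i`. The word of `t` and the 0 after it contain `j − i` zeros,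
-- so from the point `j` on only the remaining word counts.
blocks-beyond : ∀ (t : Tree i j x y) {f} → k + i ≡ l + j → blocks t (0∷ f) k ≡ f l
blocks-beyond {i} {k = k} {l = l} leaf eq
  with refl ← +-cancelʳ-≡ i k (suc l) (trans eq (+-suc l i)) = refl
blocks-beyond {j = j} {k = k} {l = l} (node {m = m} t u) {f} eq
  with n , eq′ ← beyond (≤-trans (<⇒≤ (tree-< u)) (m≤n+m j l)) = begin
  first k + blocks t (0∷ blocks u (0∷ f)) k
    ≡⟨ cong₂ _+_ (first-beyond (tree-< (node t u)) eq) (blocks-beyond t (trans eq eq′)) ⟩
  blocks u (0∷ f) n
    ≡⟨ blocks-beyond u (sym eq′) ⟩
  f l ∎
  where open ≡-Reasoning

-- The block of a point before `j` is closed by a 0 of the word of `t` or by the 0 after it, so what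
-- follows cannot reach it.
blocks-within : ∀ (t : Tree i j x y) {f} → k + i < j → blocks t (0∷ f) k ≡ blocks t none k
blocks-within {k = zero}  leaf k+i<j = refl
blocks-within {k = suc k} leaf k+i<j = contradiction k+i<j (≤⇒≯ (s≤s (m≤n+m _ k)))
blocks-within {i} {j} {k = k} (node {m = m} t u) {f} k+i<j = cong (first k +_) eq
  where
  eq : blocks t (0∷ blocks u (0∷ f)) k ≡ blocks t (0∷ blocks u none) k
  eq with m ≤? k + i
  ... | no m≰k+i = trans (blocks-within t (≰⇒> m≰k+i)) (sym (blocks-within t (≰⇒> m≰k+i)))
  ... | yes m≤k+i with n , e ← beyond m≤k+i =
    trans (blocks-beyond t e)
          (trans (blocks-within u (subst (_< j) e k+i<j)) (sym (blocks-beyond t e)))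

0∷none : 0∷ none ≗ none
0∷none zero    = refl
0∷none (suc _) = refl

-- Supplies the trailing 0 that `blocks-injective` asks for.
blocks-0∷none : ∀ (t : Tree i j x y) → blocks t (0∷ none) ≗ blocks t none
blocks-0∷none t = blocks-cong t 0∷none

-- The bound starts at `k = j − i − 1`, the number of 0s in the word, and a Dyck word has no 1 after
-- its last 0.
blocks-none-beyond : ∀ (t : Tree i j x y) → j ≤ suc k + i → blocks t none k ≡ 0
blocks-none-beyond leaf j≤ = refl
blocks-none-beyond {j = j} {k = k} (node {m = m} t u) j≤
  with n , e ← beyond (≤-pred (≤-trans (tree-< u) j≤)) =
  trans (cong₂ _+_ (first-beyond (tree-< t) e) (blocks-beyond t e))
        (blocks-none-beyond u (subst (λ a → j ≤ suc a) e j≤))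

-- Outdegrees in a triangulation as block lengths

subset-empty : ∀ {N} (S : Subset N) → (∀ v → v ∉ S) → ∣ S ∣ ≡ 0
subset-empty {N} S ∉S rewrite Empty-unique (λ (v , v∈S) → ∉S v v∈S) = ∣⊥∣≡0 N

subset-remove : ∀ {N} {v : Fin N} {S : Subset N} → v ∈ S → ∣ S ∣ ≡ suc ∣ S - v ∣
subset-remove {S = inside  ∷ p} here        = cong (suc ∘ ∣_∣) (sym (p─⊥≡p p))
subset-remove {S = inside  ∷ S} (there v∈S) = cong suc (subset-remove v∈S)
subset-remove {S = outside ∷ S} (there v∈S) = subset-remove v∈S

subset-remove⁻ : ∀ {N} {v w : Fin N} (S : Subset N) → v ∈ S - w → v ∈ S × v ≢ w
subset-remove⁻ {w = w} S v∈ = p─q⊆p S ⁅ w ⁆ v∈ , λ { refl →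
  -- If `w` were in `S - w`, removing it once more would lower the cardinality, but a second removal
  -- changes nothing.
  <-irrefl (cong ∣_∣ (p─q─q≡p─q S ⁅ w ⁆)) (x∈p⇒∣p-x∣<∣p∣ {p = S - w} v∈) }

side-left : {l : Tree i m (suc x) y} {r : Tree m j (suc y) z} →
            Side (node l r) a b → i < a → a < m → Side l a b
side-left root    i<i a<m = contradiction i<i (<-irrefl refl)
side-left (inl s) i<a a<m = s
side-left (inr s) i<a a<m = contradiction (side-lb s) (<⇒≱ a<m)

-- `S` holds the heads of the non-short sides leaving the point `k + i`. From `m` on these lie in
-- the right subtree, strictly between `i` and `m` in the left one; only at `i` does the root count
-- as well.
outdegree : ∀ {N} (t : Tree i j x y) (S : Subset N) k → j < N →
            (∀ v → v ∈ S ⇔ (Side t (k + i) (toℕ v) × toℕ v ≢ suc (k + i))) →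
            ∣ S ∣ ≡ blocks t none k
outdegree {i} leaf S k j<N S≡ = subset-empty S λ v v∈S → short (to (S≡ v) v∈S)
  where
  short : ¬ (Side (leaf {i}) (k + i) a × a ≢ suc (k + i))
  short (s , ≢) = ≢ (≤-antisym (≤-trans (side-ub s) (s≤s (m≤n+m i k))) (side-< s))
outdegree {i} {j} (node {m = m} t u) S k j<N S≡ with m ≤? k + i
... | yes m≤k+i with n , e ← beyond m≤k+i = begin
  ∣ S ∣
    ≡⟨ outdegree u S n j<N (λ v → subst (λ a → v ∈ S ⇔ (Side u a (toℕ v) × toℕ v ≢ suc a)) e
         (mk⇔ (λ v∈S → map₁ (flip inr⁻ m≤k+i) (to (S≡ v) v∈S)) (from (S≡ v) ∘ map₁ inr))) ⟩
  blocks u none n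
    ≡⟨ cong₂ _+_ (first-beyond (tree-< t) e) (blocks-beyond t e) ⟨
  first k + blocks t (0∷ blocks u none) k ∎
  where open ≡-Reasoning
outdegree {i} {j} (node {m = m} t u) S (suc k) j<N S≡ | no m≰k+i =
  trans (outdegree t S (suc k) (<-trans (tree-< u) j<N) λ v → mk⇔
          (λ v∈S → map₁ (λ s → side-left s (s≤s (m≤n+m i k)) (≰⇒> m≰k+i)) (to (S≡ v) v∈S))
          (from (S≡ v) ∘ map₁ inl))
        (sym (blocks-within t (≰⇒> m≰k+i)))
-- Here `v` is the point `j`: taking the head of the root out of `S` accounts for the 1 in
-- `first zero` and leaves the sides of the left subtree.
outdegree {i} {j} (node {m = m} t u) S zero j<N S≡ | no m≰i with v , refl ← finite j<N =
  trans (subset-remove (from (S≡ v) (root , >⇒≢ (≤-<-trans (tree-< t) (tree-< u)))))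
        (cong suc (trans (outdegree t (S - v) zero (<-trans (tree-< u) j<N) S-v≡)
                         (sym (blocks-within t (≰⇒> m≰i)))))
  where
  S-v≡ : ∀ w → w ∈ S - v ⇔ (Side t i (toℕ w) × toℕ w ≢ suc i)
  S-v≡ w = mk⇔ left λ (s , ≢1+i) →
    x∈p∧x≢y⇒x∈p-y (from (S≡ w) (inl s , ≢1+i))
                  λ { refl → <⇒≱ (tree-< u) (side-ub s) }
    where
    below-root : Side (node t u) i a → a ≢ toℕ v → Side t i a
    below-root root    ≢v = contradiction refl ≢v
    below-root (inl s) ≢v = s
    below-root (inr s) ≢v = contradiction (side-lb s) m≰i
    left : w ∈ S - v → Side t i (toℕ w) × toℕ w ≢ suc i
    left w∈ with w∈S , w≢v ← subset-remove⁻ S w∈ =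
      map₁ (λ s → below-root s (w≢v ∘ toℕ-injective)) (to (S≡ w) w∈S)

-- The word of a matching as the word of its tree

segment : (ℕ → ℕ) → ℕ → ∀ N → Vec ℕ N
segment β x zero    = []
segment β x (suc N) = β x ∷ segment β (suc x) N

ones-zero : ∀ {N} (bs : Vec ℕ N) → a ≡ 0 → (flip onesAfterZeros (a ∷ bs)) ≗ 0∷ (flip onesAfterZeros bs)
ones-zero bs refl zero    = refl
ones-zero bs refl (suc k) = refl

ones-one : ∀ {N} (bs : Vec ℕ N) → a ≢ 0 → ∀ k → onesAfterZeros k (a ∷ bs) ≡ first k + onesAfterZeros k bs
ones-one {zero}  bs a≢0 k       = contradiction refl a≢0
ones-one {suc _} bs a≢0 zero    = refl
ones-one {suc _} bs a≢0 (suc k) = refl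

-- The hypothesis on `β` makes positions x, ..., y - 1 spell the Dyck word of `t`. `M` and `N` are
-- the numbers of symbols left from `x` and from `y`, so both sums are the end of the whole word.
ones-blocks : ∀ (t : Tree i j x y) (β : ℕ → ℕ) →
              (∀ {a b} → ArcOf t a b → β a ≢ 0 × β b ≡ 0) → ∀ M N → x + M ≡ y + N → ∀ k →
              onesAfterZeros k (segment β x M) ≡ blocks t (flip onesAfterZeros (segment β y N)) k
ones-blocks {x = x} leaf β arcs M N eq k with refl ← +-cancelˡ-≡ x M N eq = refl
ones-blocks {x = x} {y = z} (node {y = y} l r) β arcs zero N eq k =
  contradiction (≤-trans (m≤m+n z N) (≤-reflexive (trans (sym eq) (+-identityʳ x))))
                (<⇒≱ (<-trans (tree-≤ l) (tree-≤ r)))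
ones-blocks {x = x} {y = z} (node {y = y} l r) β arcs (suc M) N eq k
  -- `n` is the length of the word of `r`: from `y` on there are the closing 0, these `n` symbols
  -- and the last `N`.
  with n , refl ← m≤n⇒∃[o]m+o≡n (tree-≤ r) = begin
  onesAfterZeros k (β x ∷ segment β (suc x) M)
    ≡⟨ ones-one (segment β (suc x) M) (proj₁ (arcs root)) k ⟩
  first k + onesAfterZeros k (segment β (suc x) M)
    ≡⟨ cong (first k +_) (ones-blocks l β (arcs ∘ inl) M (suc (n + N)) eq-l k) ⟩
  first k + blocks l (flip onesAfterZeros (segment β y (suc (n + N)))) k
    ≡⟨ cong (first k +_) (blocks-cong l (ones-zero (segment β (suc y) (n + N)) (proj₂ (arcs root))) k) ⟩
  first k + blocks l (0∷ flip onesAfterZeros (segment β (suc y) (n + N))) k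
    ≡⟨ cong (first k +_) (blocks-cong l (0∷-cong (ones-blocks r β (arcs ∘ inr) (n + N) N eq-r)) k) ⟩
  first k + blocks l (0∷ blocks r (flip onesAfterZeros (segment β (suc y + n) N))) k ∎
  where
  open ≡-Reasoning
  eq-r : suc y + (n + N) ≡ suc (y + n) + N
  eq-r = sym (+-assoc (suc y) n N)
  eq-l : suc x + M ≡ y + suc (n + N)
  eq-l = trans (sym (+-suc x M)) (trans eq (trans (+-assoc (suc y) n N) (sym (+-suc y (n + N)))))

extend : ∀ {N} → (Fin N → ℕ) → ℕ → ℕ
extend {zero}  f p       = 0
extend {suc N} f zero    = f zero
extend {suc N} f (suc p) = extend (f ∘ suc) p

extend-toℕ : ∀ {N} (f : Fin N → ℕ) v → extend f (toℕ v) ≡ f v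
extend-toℕ f zero    = refl
extend-toℕ f (suc v) = extend-toℕ (f ∘ suc) v

tabulate-segment : ∀ N (f : Fin N → ℕ) (β : ℕ → ℕ) x → (∀ v → β (x + toℕ v) ≡ f v) →
                   tabulate f ≡ segment β x N
tabulate-segment zero    f β x eq = refl
tabulate-segment (suc N) f β x eq =
  cong₂ _∷_ (trans (sym (eq zero)) (cong β (+-identityʳ x)))
            (tabulate-segment N (f ∘ suc) β (suc x)
              λ v → trans (cong β (sym (+-suc x (toℕ v)))) (eq (suc v)))

-- Each of the `j − i − 1` inner nodes spells two symbols; the equation has its subtractions
-- cleared. The summand added for cancellation turns the goal into the sum of the two induction
-- hypotheses.
tree-length : ∀ (t : Tree i j x y) → y + (suc i + suc i) ≡ x + (j + j)
tree-length leaf = refl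
tree-length {i} {j} {x} {z} (node {m = m} {y = y} l r) =
  +-cancelʳ-≡ (y + (suc m + suc m)) _ _ (begin
    z + (suc i + suc i) + (y + (suc m + suc m))   ≡⟨ regroup z (suc i) y (suc m) ⟩
    z + (suc m + suc m) + (y + (suc i + suc i))   ≡⟨ cong₂ _+_ (tree-length r) (tree-length l) ⟩
    suc y + (j + j) + (suc x + (m + m))           ≡⟨ regroup′ y j x m ⟩
    x + (j + j) + (y + (suc m + suc m))           ∎)
  where
  open ≡-Reasoning
  regroup : ∀ a b c d → a + (b + b) + (c + (d + d)) ≡ a + (d + d) + (c + (b + b))
  regroup = solve 4 (λ a b c d → a :+ (b :+ b) :+ (c :+ (d :+ d)) := a :+ (d :+ d) :+ (c :+ (b :+ b))) refl
  regroup′ : ∀ a b c d → suc a + (b + b) + (suc c + (d + d)) ≡ c + (b + b) + (a + (suc d + suc d))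
  regroup′ = solve 4 (λ a b c d → con 1 :+ a :+ (b :+ b) :+ (con 1 :+ c :+ (d :+ d)) :=
                       c :+ (b :+ b) :+ (a :+ (con 1 :+ d :+ (con 1 :+ d)))) refl

module _ {n} (T : Triangulation n) where

  triangulates-D : {t : Tree 0 (suc n) 0 y} → Triangulates T t →
                   ∀ v → D T v ≡ blocks t none (toℕ v)
  triangulates-D {t = t} T≡ v =
    outdegree t (Triangulation.graph T v′ - suc (inject₁ v)) (toℕ v) ≤-refl S≡
    where
    v′ = inject₁ (inject₁ v)
    v′≡v : toℕ v′ ≡ toℕ v + 0
    v′≡v = trans (toℕ-inject₁ (inject₁ v)) (trans (toℕ-inject₁ v) (sym (+-identityʳ (toℕ v))))
    next : toℕ (suc (inject₁ v)) ≡ suc (toℕ v + 0)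
    next = cong suc (trans (toℕ-inject₁ v) (sym (+-identityʳ (toℕ v))))
    S≡ : ∀ w → w ∈ Triangulation.graph T v′ - suc (inject₁ v) ⇔
               (Side t (toℕ v + 0) (toℕ w) × toℕ w ≢ suc (toℕ v + 0))
    S≡ w = mk⇔
      (λ w∈ → case subset-remove⁻ _ w∈ of λ
        { (e , ≢next) → subst (λ a → Side t a (toℕ w)) v′≡v (to (T≡ v′ w) e) ,
                        λ eq → ≢next (toℕ-injective (trans eq (sym next))) })
      λ (s , ≢next) → x∈p∧x≢y⇒x∈p-y (from (T≡ v′ w) (subst (λ a → Side t a (toℕ w)) (sym v′≡v) s))
                                     λ eq → ≢next (trans (cong toℕ eq) next)

module _ {n} (M : Matching n) where

  matches-B : {t : Tree 0 j 0 (2 * n)} → Matches M t →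
              flip onesAfterZeros (B M) ≗ blocks t none
  matches-B {t = t} M≡ k = begin
    onesAfterZeros k (B M)
      ≡⟨ cong (onesAfterZeros k) (tabulate-segment (2 * n) outdeg (extend outdeg) 0 (extend-toℕ outdeg)) ⟩
    onesAfterZeros k (segment (extend outdeg) 0 (2 * n))
      ≡⟨ ones-blocks t (extend outdeg) bits (2 * n) 0 (sym (+-identityʳ (2 * n))) k ⟩
    blocks t none k ∎
    where
    open ≡-Reasoning
    outdeg : Fin (2 * n) → ℕ
    outdeg v = ∣ Matching.graph M v ∣
    bits : ArcOf t a b → extend outdeg a ≢ 0 × extend outdeg b ≡ 0
    bits s with v , refl ← finite (<-trans (arc-< s) (arc-ub s)) | w , refl ← finite (arc-ub s)
      rewrite extend-toℕ outdeg v | extend-toℕ outdeg w =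
      (λ ≡0 → case trans (sym (subset-remove vw)) ≡0 of λ ()) ,
      subset-empty _ λ u wu → tail≢head M (v , w , refl , refl , vw) (w , u , refl , refl , wu)
      where
      vw = from (M≡ v w) s

-- `Corresponds` covers the first `n` blocks. All later ones are 0 in both trees, as they lie after
-- the last 0; for `u`, whose last point is unknown, this needs `j ≤ suc n`, which follows from its
-- length `2 * n`.
corresponding-trees : ∀ {n} (M : Matching n) (T : Triangulation n) → Corresponds M T →
                      {t : Tree 0 (suc n) 0 y} {u : Tree 0 j 0 (2 * n)} →
                      Triangulates T t → Matches M u →
                      _≡_ {A = TreeFrom 0 0} (_ , _ , t) (_ , _ , u)
corresponding-trees {y} {j} {n} M T M~T {t} {u} T≡ M≡ = proj₁ (blocks-injective t u λ k →
  trans (blocks-0∷none t k) (trans (agree k) (sym (blocks-0∷none u k))))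
  where
  open ≡-Reasoning
  j+j≡ : j + j ≡ suc n + suc n
  j+j≡ = trans (sym (tree-length u)) (solve 1 (λ n → con 2 :* n :+ con 2 := con 1 :+ n :+ (con 1 :+ n)) refl n)
  j≤1+n : j ≤ suc n
  j≤1+n = ≮⇒≥ λ 1+n<j → <⇒≢ (+-mono-< 1+n<j 1+n<j) (sym j+j≡)
  agree : blocks t none ≗ blocks u none
  agree k with k <? n
  ... | yes k<n with v , refl ← finite k<n =
    trans (sym (triangulates-D T T≡ v)) (trans (M~T v) (matches-B M M≡ (toℕ v)))
  ... | no k≮n = trans (blocks-none-beyond t n≤) (sym (blocks-none-beyond u (≤-trans j≤1+n n≤)))
    where
    n≤ : suc n ≤ suc k + 0
    n≤ = s≤s (≤-trans (≮⇒≥ k≮n) (m≤m+n k 0))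

-- Flips, splits and merges as rotations

-- Passes a rotated tree from `T′` to `M′`: the matching has some tree, and uniqueness makes it this
-- one.
triangulation-tree⇒matching-tree : ∀ {n} (M : Matching n) (T : Triangulation n) → Corresponds M T →
  {t : Tree 0 (suc n) 0 (2 * n)} → Triangulates T t → Matches M t
triangulation-tree⇒matching-tree M T M~T T≡
  with _ , u , M≡ ← matching-tree M
  with refl ← corresponding-trees M T M~T T≡ M≡ = M≡

matching-tree⇒triangulation-tree : ∀ {n} (M : Matching n) (T : Triangulation n) → Corresponds M T →
  {t : Tree 0 (suc n) 0 (2 * n)} → Matches M t → Triangulates T t
matching-tree⇒triangulation-tree M T M~T M≡
  with _ , u , T≡ ← triangulation-tree T
  with refl ← corresponding-trees M T M~T T≡ M≡ = T≡

common-tree : ∀ {n} (M : Matching n) (T : Triangulation n) → Corresponds M T →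
              ∃ λ (t : Tree 0 (suc n) 0 (2 * n)) → Triangulates T t × Matches M t
common-tree M T M~T
  with _ , t , T≡ ← triangulation-tree T
  with _ , u , M≡ ← matching-tree M
  with refl ← corresponding-trees M T M~T T≡ M≡ = t , T≡ , M≡

data _⇝_ (t t′ : Tree a b c d) : Set where
  rotation : Rot i j k l x y z t t′ → t ⇝ t′

module _ {n} (T : Triangulation n) {t t′ : Tree 0 (suc n) 0 y} (T≡ : Triangulates T t) where

  exchanged : ∀ {i j k l} →
    (∀ a b → Side t′ a b ⇔ ((Side t a b × ¬ (a ≡ toℕ i × b ≡ toℕ j)) ⊎ (a ≡ toℕ k × b ≡ toℕ l))) →
    ∀ a b → ((TEdge T a b × ¬ (a ≡ i × b ≡ j)) ⊎ (a ≡ k × b ≡ l)) ⇔ Side t′ (toℕ a) (toℕ b)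
  exchanged t′≡ a b = ⇔-sym (t′≡ (toℕ a) (toℕ b)) ⇔-∘ mk⇔
    (Sum.map (λ (e , ≢ij) → to (T≡ a b) e , λ (p , q) → ≢ij (toℕ-injective p , toℕ-injective q))
             λ (p , q) → cong toℕ p , cong toℕ q)
    (Sum.map (λ (s , ≢ij) → from (T≡ a b) s , λ (p , q) → ≢ij (cong toℕ p , cong toℕ q))
             λ (p , q) → toℕ-injective p , toℕ-injective q)

module _ {n} (T T′ : Triangulation n) where

  -- `Exchange` describes all edges of `T′`, so the rotated tree triangulates `T′` at once, without
  -- a tree being extracted from `T′`.
  flip⇒rotation : {t : Tree 0 (suc n) 0 y} → Triangulates T t → DiagonalFlip T T′ →
                  ∃ λ t′ → Triangulates T′ t′ × (t ⇝ t′ ⊎ t′ ⇝ t)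
  flip⇒rotation {t = t} T≡ F = case F.exchange of λ
    { (inj₁ (ik , ex)) → case rotateʳ t quadrilateral (to (T≡ F.i F.k) ik) of λ
        { (_ , _ , _ , t′ , ρ) →
          t′ , (λ a b → exchanged T T≡ (rot-exchange ρ) a b ⇔-∘ ex a b) , inj₁ (rotation ρ) }
    ; (inj₂ (jl , ex)) → case rotateˡ t quadrilateral (to (T≡ F.j F.l) jl) of λ
        { (_ , _ , _ , t′ , ρ) →
          t′ , (λ a b → exchanged T T≡ (rot-exchange⁻ ρ) a b ⇔-∘ ex a b) , inj₂ (rotation ρ) } }
    where
    module F = DiagonalFlip F
    quadrilateral : Quadrilateral t (toℕ F.i) (toℕ F.j) (toℕ F.k) (toℕ F.l)
    quadrilateral = to (T≡ _ _) F.edge-ij , to (T≡ _ _) F.edge-jk ,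
                    to (T≡ _ _) F.edge-kl , to (T≡ _ _) F.edge-il

  rotation⇒flip : {t t′ : Tree 0 (suc n) 0 y} → Triangulates T t → Triangulates T′ t′ →
                  t ⇝ t′ ⊎ t′ ⇝ t → DiagonalFlip T T′
  rotation⇒flip T≡ T′≡ (inj₁ (rotation ρ))
    with (ij , jk , kl , il) , ik ← rot-quadrilateral ρ
    with l<N ← s≤s (side-ub il)
    with k<N ← <-trans (side-< kl) l<N
    with i , refl ← finite (<-trans (side-< ij) (<-trans (side-< jk) k<N))
       | j , refl ← finite (<-trans (side-< jk) k<N)
       | k , refl ← finite k<N
       | l , refl ← finite l<N = record
    { i = i ; j = j ; k = k ; l = l
    ; i<j = side-< ij ; j<k = side-< jk ; k<l = side-< kl
    ; edge-ij = from (T≡ _ _) ij ; edge-jk = from (T≡ _ _) jk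
    ; edge-kl = from (T≡ _ _) kl ; edge-il = from (T≡ _ _) il
    ; exchange = inj₁ (from (T≡ _ _) ik , λ a b →
        ⇔-sym (exchanged T T≡ (rot-exchange ρ) a b) ⇔-∘ T′≡ a b) }
  rotation⇒flip T≡ T′≡ (inj₂ (rotation ρ))
    with (ij , jk , kl , il) , jl ← rot-quadrilateral⁻ ρ
    with l<N ← s≤s (side-ub il)
    with k<N ← <-trans (side-< kl) l<N
    with i , refl ← finite (<-trans (side-< ij) (<-trans (side-< jk) k<N))
       | j , refl ← finite (<-trans (side-< jk) k<N)
       | k , refl ← finite k<N
       | l , refl ← finite l<N = record
    { i = i ; j = j ; k = k ; l = l
    ; i<j = side-< ij ; j<k = side-< jk ; k<l = side-< kl
    ; edge-ij = from (T≡ _ _) ij ; edge-jk = from (T≡ _ _) jk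
    ; edge-kl = from (T≡ _ _) kl ; edge-il = from (T≡ _ _) il
    ; exchange = inj₂ (from (T≡ _ _) jl , λ a b →
        ⇔-sym (exchanged T T≡ (rot-exchange⁻ ρ) a b) ⇔-∘ T′≡ a b) }

module _ {n} (M : Matching n) {t : Tree i j 0 (2 * n)} (M≡ : Matches M t) where

  section : ∀ {p q a b} → InSection M p q a b ⇔ Section t (toℕ p) (toℕ q) (toℕ a) (toℕ b)
  section = mk⇔ (map₁ (to (M≡ _ _))) (map₁ (from (M≡ _ _)))

  pair-≡ : ∀ {N} {a b p q : Fin N} → (a ≡ p × b ≡ q) ⇔ (toℕ a ≡ toℕ p × toℕ b ≡ toℕ q)
  pair-≡ = mk⇔ (λ (e , f) → cong toℕ e , cong toℕ f) λ (e , f) → toℕ-injective e , toℕ-injective f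

  unmoved : ∀ {p q s r a b} →
    (Arc M a b × ¬ InSection M p q a b × ¬ (a ≡ s × b ≡ r)) ⇔
    (ArcOf t (toℕ a) (toℕ b) × ¬ Section t (toℕ p) (toℕ q) (toℕ a) (toℕ b) ×
     ¬ (toℕ a ≡ toℕ s × toℕ b ≡ toℕ r))
  unmoved = mk⇔ (λ (e , f , g) → to (M≡ _ _) e , f ∘ from section , g ∘ from pair-≡)
                λ (e , f , g) → from (M≡ _ _) e , f ∘ to section , g ∘ to pair-≡

  split-arcs : ∀ {p q s r} a b →
    ( (∃₂ λ c d → InSection M p q c d × suc (label a) ≡ label c × suc (label b) ≡ label d)
    ⊎ (a ≡ q × b ≡ r)
    ⊎ (Arc M a b × ¬ InSection M p q a b × ¬ (a ≡ s × b ≡ r))) ⇔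
    SplitArc t (toℕ p) (toℕ q) (toℕ s) (toℕ r) (toℕ a) (toℕ b)
  split-arcs {p} {q} a b = mk⇔
    (Sum.map (λ (c , d , s , e , f) → toℕ c , toℕ d , to section s , suc-injective e , suc-injective f)
             (Sum.map (to pair-≡) (to unmoved)))
    (Sum.map moved (Sum.map (from pair-≡) (from unmoved)))
    where
    moved : (∃₂ λ c d → Section t (toℕ p) (toℕ q) c d × suc (toℕ a) ≡ c × suc (toℕ b) ≡ d) →
            ∃₂ λ c d → InSection M p q c d × suc (label a) ≡ label c × suc (label b) ≡ label d
    moved (_ , _ , s@(u , _) , e , f)
      with c , refl ← finite (<-trans (arc-< u) (arc-ub u)) | d , refl ← finite (arc-ub u) =
      c , d , from section s , cong suc e , cong suc f

  merge-arcs : ∀ {p q i r} a b →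
    ( (∃₂ λ c d → InSection M i r c d × label a ≡ suc (label c) × label b ≡ suc (label d))
    ⊎ (a ≡ i × b ≡ q)
    ⊎ (Arc M a b × ¬ InSection M i r a b × ¬ (a ≡ p × b ≡ q))) ⇔
    MergeArc t (toℕ p) (toℕ q) (toℕ i) (toℕ r) (toℕ a) (toℕ b)
  merge-arcs {i = i} {r} a b = mk⇔
    (Sum.map (λ (c , d , s , e , f) → toℕ c , toℕ d , to section s , suc-injective e , suc-injective f)
             (Sum.map (to pair-≡) (to unmoved)))
    (Sum.map moved (Sum.map (from pair-≡) (from unmoved)))
    where
    moved : (∃₂ λ c d → Section t (toℕ i) (toℕ r) c d × toℕ a ≡ suc c × toℕ b ≡ suc d) →
            ∃₂ λ c d → InSection M i r c d × label a ≡ suc (label c) × label b ≡ suc (label d)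
    moved (_ , _ , s@(u , _) , e , f)
      with c , refl ← finite (<-trans (arc-< u) (arc-ub u)) | d , refl ← finite (arc-ub u) =
      c , d , from section s , cong suc e , cong suc f

module _ {n} (M M′ : Matching n) where

  split⇒rotation : ∀ {p q} {t : Tree i j 0 (2 * n)} → Matches M t → Split M p q M′ →
                   ∃ λ t′ → Matches M′ t′ × t ⇝ t′
  split⇒rotation {p = p} {q} {t} M≡ S
    with p≡ ← suc-injective (Split.s+1≡p S)
    with _ , _ , _ , _ , _ , t′ , q≡ , ρ ←
           splitting t (subst (λ a → ArcOf t a (toℕ q)) (sym p≡) (to (M≡ _ _) (Split.α S)))
                       (to (M≡ _ _) (Split.β S)) =
    t′ , (λ a b → ⇔-sym (after (toℕ a) (toℕ b)) ⇔-∘ (split-arcs M M≡ a b ⇔-∘ S.result a b)) ,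
    rotation ρ
    where
    module S = Split S
    after = subst₂ (λ p q → ∀ a b → ArcOf t′ a b ⇔ SplitArc t p q (toℕ S.s) (toℕ S.r) a b)
                   p≡ (sym q≡) (rot-split ρ)

  rotation⇒split : {t t′ : Tree i j 0 (2 * n)} → Matches M t → Matches M′ t′ → t ⇝ t′ →
                   ∃₂ λ p q → Split M p q M′
  rotation⇒split {t = t} {t′} M≡ M′≡ (rotation ρ)
    with α ← rot-α ρ | β ← rot-β ρ
    with p , p≡ ← finite (<-trans (arc-< α) (arc-ub α)) | q , q≡ ← finite (arc-ub α)
       | s , refl ← finite (<-trans (arc-< β) (arc-ub β)) | r , refl ← finite (arc-ub β) =
    p , q , record
    { α = from (M≡ p q) (subst₂ (ArcOf t) (sym p≡) (sym q≡) α)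
    ; p>1 = s≤s (subst (0 <_) (sym p≡) (s≤s z≤n))
    ; s = s ; r = r
    ; s+1≡p = cong suc (sym p≡)
    ; β = from (M≡ s r) β
    ; result = λ a b → ⇔-sym (split-arcs M M≡ a b) ⇔-∘
        (subst₂ (λ p q → ∀ a b → ArcOf t′ a b ⇔ SplitArc t p q (toℕ s) (toℕ r) a b)
                (sym p≡) (sym q≡) (rot-split ρ) (toℕ a) (toℕ b) ⇔-∘ M′≡ a b) }

  merge⇒rotation : ∀ {p q} {t : Tree i j 0 (2 * n)} → Matches M t → Merge M p q M′ →
                   ∃ λ t′ → Matches M′ t′ × t′ ⇝ t
  merge⇒rotation {p = p} {q} {t} M≡ S
    with p≡ ← suc-injective (Merge.r+1≡p S)
    with _ , _ , _ , _ , t′ , ρ ←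
           merging t (to (M≡ _ _) (Merge.β S))
                     (subst (λ a → ArcOf t a (toℕ q)) (sym p≡) (to (M≡ _ _) (Merge.α S))) =
    t′ , (λ a b → ⇔-sym (after (toℕ a) (toℕ b)) ⇔-∘ (merge-arcs M M≡ a b ⇔-∘ S.result a b)) ,
    rotation ρ
    where
    module S = Merge S
    after = subst (λ p → ∀ a b → ArcOf t′ a b ⇔ MergeArc t p (toℕ q) (toℕ S.i) (toℕ S.r) a b)
                  p≡ (rot-merge ρ)

  rotation⇒merge : {t t′ : Tree i j 0 (2 * n)} → Matches M t → Matches M′ t′ → t′ ⇝ t →
                   ∃₂ λ p q → Merge M p q M′
  rotation⇒merge {t = t} {t′} M≡ M′≡ (rotation ρ)
    with α ← rot-α⁻ ρ | β ← rot-β⁻ ρ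
    with p , p≡ ← finite (<-trans (arc-< α) (arc-ub α)) | q , refl ← finite (arc-ub α)
       | i , refl ← finite (<-trans (arc-< β) (arc-ub β)) | r , refl ← finite (arc-ub β) =
    p , q , record
    { α = from (M≡ p q) (subst (λ a → ArcOf t a (toℕ q)) (sym p≡) α)
    -- β runs from `x` to `y` with `x < y`, so `y` is at least 1 and α, starting at `suc y`, has a
    -- start with label at least 3.
    ; p>2 = s≤s (subst (1 <_) (sym p≡) (s≤s (≤-trans (s≤s z≤n) (arc-< β))))
    ; i = i ; r = r
    ; r+1≡p = cong suc (sym p≡)
    ; β = from (M≡ i r) β
    ; result = λ a b → ⇔-sym (merge-arcs M M≡ a b) ⇔-∘
        (subst (λ p → ∀ a b → ArcOf t′ a b ⇔ MergeArc t p (toℕ q) (toℕ i) (toℕ r) a b)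
               (sym p≡) (rot-merge ρ) (toℕ a) (toℕ b) ⇔-∘ M′≡ a b) }

corollary10 : ∀ (n : ℕ) → n ≥ 1 →
    (∀ (T T' : Triangulation n) (M M' : Matching n) →
    Corresponds M T → Corresponds M' T' →
    DiagonalFlip T T' →
    ∃₂ λ p q → Arc M p q × label p > 1 × (Merge M p q M' ⊎ Split M p q M'))
    ×
    (∀ (M M' : Matching n) (T T' : Triangulation n) →
    Corresponds M T → Corresponds M' T' →
    (∃₂ λ p q → Arc M p q × label p > 1 × (Merge M p q M' ⊎ Split M p q M')) →
    DiagonalFlip T T')
corollary10 n _ = flip⇒arc-move , arc-move⇒flip
  where
  flip⇒arc-move : ∀ T T′ M M′ → Corresponds M T → Corresponds M′ T′ → DiagonalFlip T T′ →
                  ∃₂ λ p q → Arc M p q × label p > 1 × (Merge M p q M′ ⊎ Split M p q M′)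
  flip⇒arc-move T T′ M M′ M~T M′~T′ F
    with t , T≡ , M≡ ← common-tree M T M~T
    with t′ , T′≡ , t⇝t′ ← flip⇒rotation T T′ T≡ F
    with M′≡ ← triangulation-tree⇒matching-tree M′ T′ M′~T′ T′≡
    with t⇝t′
  ... | inj₁ ρ with p , q , S ← rotation⇒split M M′ M≡ M′≡ ρ =
    p , q , Split.α S , Split.p>1 S , inj₂ S
  ... | inj₂ ρ with p , q , S ← rotation⇒merge M M′ M≡ M′≡ ρ =
    p , q , Merge.α S , <⇒≤ (Merge.p>2 S) , inj₁ S

  arc-move⇒flip : ∀ M M′ T T′ → Corresponds M T → Corresponds M′ T′ →
                  (∃₂ λ p q → Arc M p q × label p > 1 × (Merge M p q M′ ⊎ Split M p q M′)) →
                  DiagonalFlip T T′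
  arc-move⇒flip M M′ T T′ M~T M′~T′ (p , q , _ , _ , move)
    with t , T≡ , M≡ ← common-tree M T M~T
    with move
  ... | inj₁ S with t′ , M′≡ , ρ ← merge⇒rotation M M′ M≡ S =
    rotation⇒flip T T′ T≡ (matching-tree⇒triangulation-tree M′ T′ M′~T′ M′≡) (inj₂ ρ)
  ... | inj₂ S with t′ , M′≡ , ρ ← split⇒rotation M M′ M≡ S =
    rotation⇒flip T T′ T≡ (matching-tree⇒triangulation-tree M′ T′ M′~T′ M′≡) (inj₁ ρ)
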